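{- Let $m,n$ be integers with $3\leqslant m\leqslant n$. Then the grid graph $Grid_{m\times n}$ is $d$-balanced, i.e. $\gamma_{bd}(Grid_{m\times n})=0$.
   Context: For a simple undirected finite graph $G$ and $v\in V(G)$, the closed neighborhood is $N_G[v]=\{u\in V(G): uv\in E(G)\}\cup\{v\}$. A function $f\colon V(G)\to\{ -1,0,1\}$ is a balanced domination function (BDF) on $G$ if $\sum_{u\in N_G[v]} f(u)=0$ for every $v\in V(G)$. Its weight is $\omega_f=\sum_{v\in V(G)} f(v)$. The balanced domination number $\gamma_{bd}(G)$ is the maximum of $\omega_f$ over all BDFs $f$ on $G$. The graph $G$ is called $d$-balanced if $\gamma_{bd}(G)=0$. The grid graph $Grid_{m\times n}$ is the Cartesian product $P_m\square P_n$ of paths with $m$ and $n$ vertices: its vertices are $v_{i,j}$, $1\leqslant i\leqslant m$, $1\leqslant j\leqslant n$, and two vertices are adjacent iff they are consecutive in the same row or consecutive in the same column. -}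

module Defs where

import Algebra.Properties.Monoid.Sum
open import Data.Bool.Base using (if_then_else_)
open import Data.Fin.Base using (Fin; toℕ)
open import Data.Fin.Properties using (*↔×; _≟_)
open import Data.Integer.Base using (ℤ; 0ℤ; 1ℤ; -1ℤ; _≤_)
open import Data.Integer.Properties using (+-0-monoid)
open import Data.List.Base using ([]; _∷_)
open import Data.List.Membership.Propositional using (_∈_)
import Data.Nat.Base as ℕ
import Data.Nat.Properties as ℕ
open import Data.Product.Base using (_×_; _,_; ∃-syntax)
open import Data.Product.Function.NonDependent.Propositional using (_×-↔_)
open import Data.Sum.Base using (_⊎_; inj₁; inj₂; swap)
open import Function.Bundles using (_↔_; Inverse)
open import Function.Construct.Composition using (_↔-∘_)
open import Function.Construct.Identity using (↔-id)
open import Function.Construct.Symmetry using (↔-sym)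
open import Function.Properties.Inverse using (↔⇒↣)
open import Relation.Binary.Definitions using (Decidable; DecidableEquality; Irreflexive; Symmetric)
open import Relation.Binary.PropositionalEquality using (_≡_; refl; sym)
open import Relation.Nullary.Decidable using (does; _×-dec_; _⊎-dec_; via-injection)

open Algebra.Properties.Monoid.Sum +-0-monoid using (sum)

record Graph : Set₁ where
  field
    V      : Set
    order  : ℕ.ℕ
    enum   : V ↔ Fin order
    Adj    : V → V → Set
    adj?   : Decidable Adj
    symm   : Symmetric Adj
    irrefl : Irreflexive _≡_ Adj

  _≟ᵛ_ : DecidableEquality V
  _≟ᵛ_ = via-injection (↔⇒↣ enum) _≟_

  _∈N[_] : V → V → Set
  u ∈N[ v ] = Adj u v ⊎ u ≡ v

  _∈N[_]? : Decidable _∈N[_]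
  u ∈N[ v ]? = adj? u v ⊎-dec (u ≟ᵛ v)

  ∑ⱽ : (V → ℤ) → ℤ
  ∑ⱽ f = sum (λ i → f (Inverse.from enum i))

  ∑N[_] : V → (V → ℤ) → ℤ
  ∑N[ v ] f = ∑ⱽ (λ u → if does (u ∈N[ v ]?) then f u else 0ℤ)

module _ (G : Graph) where
  open Graph G

  record IsBDF (f : V → ℤ) : Set where
    field
      values   : ∀ v → f v ∈ -1ℤ ∷ 0ℤ ∷ 1ℤ ∷ []
      balanced : ∀ v → ∑N[ v ] f ≡ 0ℤ

  weight : (V → ℤ) → ℤ
  weight = ∑ⱽ

  -- γbd≡ k says that γ_bd(G) = k: the maximum weight of a BDF on G is k.
  γbd≡ : ℤ → Set
  γbd≡ k = (∃[ f ] (IsBDF f × weight f ≡ k)) × (∀ f → IsBDF f → weight f ≤ k)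

  DBalanced : Set
  DBalanced = γbd≡ 0ℤ

Path : ℕ.ℕ → Graph
Path n = record
  { V      = Fin n
  ; order  = n
  ; enum   = ↔-id (Fin n)
  ; Adj    = λ i j → toℕ j ≡ ℕ.suc (toℕ i) ⊎ toℕ i ≡ ℕ.suc (toℕ j)
  ; adj?   = λ i j → (toℕ j ℕ.≟ ℕ.suc (toℕ i)) ⊎-dec (toℕ i ℕ.≟ ℕ.suc (toℕ j))
  ; symm   = swap
  ; irrefl = λ { refl (inj₁ p) → ℕ.1+n≢n (sym p) ; refl (inj₂ p) → ℕ.1+n≢n (sym p) }
  }

infixr 7 _□_

_□_ : Graph → Graph → Graph
G □ H = record
  { V      = G.V × H.V
  ; order  = G.order ℕ.* H.order
  ; enum   = ↔-sym *↔× ↔-∘ (G.enum ×-↔ H.enum)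
  ; Adj    = λ { (a , b) (c , d) → (a ≡ c × H.Adj b d) ⊎ (G.Adj a c × b ≡ d) }
  ; adj?   = λ { (a , b) (c , d) → ((a G.≟ᵛ c) ×-dec H.adj? b d) ⊎-dec (G.adj? a c ×-dec (b H.≟ᵛ d)) }
  ; symm   = λ { (inj₁ (p , e)) → inj₁ (sym p , H.symm e) ; (inj₂ (e , p)) → inj₂ (G.symm e , sym p) }
  ; irrefl = λ { refl (inj₁ (_ , e)) → H.irrefl refl e ; refl (inj₂ (e , _)) → G.irrefl refl e }
  }
  where
  module G = Graph G
  module H = Graph H

Grid : ℕ.ℕ → ℕ.ℕ → Graph
Grid m n = Path m □ Path n

{-# OPTIONS --safe #-}
module Submission where

-- A BDF f, padded by a zero border, is symmetrised over the two reflections of the grid and then extended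
-- to E : ℕ² → ℤ with E (x + M) y = - E x y and E x (y + N) = - E x y, where M = m + 1 and N = n + 1.
-- E is balanced everywhere and ∣ E ∣ ≤ 4, and the weight of f vanishes once E = 0.
--
-- Dilation: let X and Y be the shifts. For a prime p > 20, the Frobenius congruence turns
-- 1 + X + X⁻¹ + Y + Y⁻¹ = 0 on E into 1 + Xᵖ + X⁻ᵖ + Yᵖ + Y⁻ᵖ ≡ 0 mod p, and a sum of five values bounded
-- by 4 that is divisible by p is 0. So 1 + Xʳ + X⁻ʳ + Yʳ + Y⁻ʳ = 0 for every r without prime factors ≤ 20.
--
-- Choose L = s M = t N with s, t not both even, and Q odd and divisible by the odd numbers below 40, so that
-- X^(QL) and Y^(QL) act by the signs of s and t. If L is even, take r = QL + 1: comparison with r = 1 gives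
-- 2 E = 0, or 1 + X + X⁻¹ = 0 (or the same for Y), whence X³ = 1, contradicting X^M = -1 unless E = 0.
-- If L is odd, take r = QL + 2: with a = X + X⁻¹ one gets (a + 2) (a - 1) = 0, and since (a - 1) E vanishes
-- at x = 0 by the symmetry of E, this forces (a - 1) E = 0. The same holds for Y + Y⁻¹, so 3 E = 0.

import Algebra.Properties.CommutativeMonoid.Mult as CMMult
import Algebra.Properties.CommutativeMonoid.Sum as CMSum
import Algebra.Properties.CommutativeSemigroup as CommutativeSemigroup
import Algebra.Properties.CommutativeSemiring.Binomial as Binomial
import Algebra.Properties.Semiring.Exp as Exp
import Algebra.Properties.Semiring.Mult as Mult
import Algebra.Properties.Semiring.Sum as SemiringSum
import Data.Fin.Properties as Fin
import Data.Integer.Properties as ℤ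
import Data.Nat.Properties as ℕ
open import Algebra.Bundles using (CommutativeSemiring)
open import Data.Bool.Base using (if_then_else_)
open import Data.Bool.Properties using (if-eta)
open import Data.Empty using (⊥; ⊥-elim)
open import Data.Fin.Base using (Fin; zero; suc; toℕ; fromℕ; fromℕ<; inject₁; opposite; punchIn)
open import Data.Fin.Permutation using (reverse)
open import Data.Integer.Base using (ℤ; +_; -_; _+_; _-_; _*_; 0ℤ; 1ℤ; -1ℤ; ∣_∣)
open import Data.Integer.Tactic.RingSolver using (solve-∀)
open import Data.List.Base using (List; []; _∷_; map; foldr; length)
open import Data.List.Membership.Propositional using (_∈_)
open import Data.List.Relation.Unary.All using (All; []; _∷_)
open import Data.List.Relation.Unary.Any using (here; there)
open import Data.Nat.Base as ℕ using (zero; suc; _<_; s≤s; z≤n; z<s; _!)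
open import Data.Nat.Base using (ℕ; _≤_)
open import Data.Nat.Combinatorics using (_C_; k![n∸k]!∣n!; nCk≡n!/k![n-k]!; nCn≡1)
open import Data.Nat.Coprimality using (coprime-/gcd)
open import Data.Nat.Divisibility
  using (_∣_; divides; ∣-refl; ∣-trans; m∣m*n; n∣m*n; ∣1⇒≡1; >⇒∤; ∣⇒≤; ∣m+n∣m⇒∣n)
open import Data.Nat.DivMod
  using (_/_; _%_; m/n*n≡m; m≡m%n+[m/n]*n; m%n<n; m<n⇒m%n≡m; m<n⇒m/n≡0; n/n≡1; +-distrib-/-∣ˡ; %-remove-+ˡ)
open import Data.Nat.GCD using (gcd; gcd[m,n]∣m; gcd[m,n]∣n; gcd[m,n]≢0)
open import Data.Nat.ListAction using (product)
open import Data.Nat.Primality using (Prime; euclidsLemma; ¬prime[0]; ¬prime[1]; prime⇒nonZero)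
open import Data.Nat.Primality.Factorisation using (factorise; module PrimeFactorisation)
open import Data.Product.Base using (_×_; _,_; ∃-syntax; proj₁; proj₂)
open import Data.Product.Function.NonDependent.Propositional using (_×-↔_)
open import Data.Sum.Base using (_⊎_; inj₁; inj₂)
open import Function.Base using (flip)
open import Function.Bundles using (_↔_; Inverse; _⇔_; mk⇔)
open import Function.Construct.Composition using (_↔-∘_)
open import Function.Construct.Identity using (↔-id)
open import Function.Construct.Symmetry using (↔-sym)
open import Level using (0ℓ)
open import Relation.Binary.PropositionalEquality
open import Relation.Nullary using (¬_; yes; no)
open import Relation.Nullary.Decidable using (Dec; does; _×-dec_; _⊎-dec_; dec-true; dec-false; does-⇔)
open import Defs
open CommutativeSemigroup ℕ.+-commutativeSemigroup using () renaming (x∙yz≈y∙xz to m+[n+o]≡n+[m+o])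
open CommutativeSemigroup ℕ.*-commutativeSemigroup using () renaming (xy∙z≈xz∙y to m*n*o≡m*o*n)

-- The Frobenius congruence

prime∤! : ∀ {p} → Prime p → ∀ k → k < p → ¬ (p ∣ k !)
prime∤! pp zero    _   p∣1 = ¬prime[1] (subst Prime (∣1⇒≡1 p∣1) pp)
prime∤! pp (suc k) k<p p∣k! with euclidsLemma (suc k) (k !) pp p∣k!
... | inj₁ p∣k  = >⇒∤ k<p p∣k
... | inj₂ p∣k! = prime∤! pp k (ℕ.<-trans (ℕ.n<1+n k) k<p) p∣k!

-- `p` divides `p ! = (p C k) * (k ! * (p ∸ k) !)` but neither factorial on the right, as both
-- arguments lie below `p`.
prime∣C : ∀ {p} → Prime p → ∀ k → 0 < k → k < p → p ∣ p C k
prime∣C {p@(suc q)} pp k 0<k k<p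
  with euclidsLemma (p C k) (k ! ℕ.* (p ℕ.∸ k) !) pp p∣
  where
  k≤p = ℕ.<⇒≤ k<p
  instance _ = k ℕ.!* (p ℕ.∸ k) !≢0
  p∣ : p ∣ (p C k) ℕ.* (k ! ℕ.* (p ℕ.∸ k) !)
  p∣ = subst (p ∣_) (sym (trans (cong (ℕ._* (k ! ℕ.* (p ℕ.∸ k) !)) (nCk≡n!/k![n-k]! k≤p))
                                (m/n*n≡m (k![n∸k]!∣n! k≤p))))
             (m∣m*n (q !))
... | inj₁ p∣C = p∣C
... | inj₂ p∣! with euclidsLemma (k !) ((p ℕ.∸ k) !) pp p∣!
...   | inj₁ p∣k! = ⊥-elim (prime∤! pp k k<p p∣k!)
...   | inj₂ p∣k! = ⊥-elim (prime∤! pp (p ℕ.∸ k) (ℕ.∸-monoʳ-< 0<k (ℕ.<⇒≤ k<p)) p∣k!)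

module _ {a ℓ} (S : CommutativeSemiring a ℓ) where
  private
    module S = CommutativeSemiring S
    open S using (_≈_; Carrier; semiring)
    open Exp semiring using (_^_)
    open Mult semiring renaming (_×_ to _·_)
    open CMMult S.+-commutativeMonoid using (×-distrib-+)
    open SemiringSum semiring using (sum; sum-init-last)
    open import Relation.Binary.Reasoning.Setoid S.setoid

    sum-·-multiple : ∀ p {n} (t : Fin n → Carrier) → (∀ i → ∃[ u ] t i ≈ p · u) → ∃[ u ] sum t ≈ p · u
    sum-·-multiple p {zero}  t h = S.0# , (begin
      S.0#                 ≈⟨ S.zeroʳ _ ⟨
      (p · S.0#) S.* S.0#  ≈⟨ ×-assoc-* p S.0# S.0# ⟩
      p · (S.0# S.* S.0#)  ≈⟨ ×-congʳ p (S.zeroˡ _) ⟩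
      p · S.0#             ∎)
    sum-·-multiple p {suc n} t h with h zero | sum-·-multiple p (λ i → t (suc i)) (λ i → h (suc i))
    ... | u , e | v , e′ = u S.+ v , S.trans (S.+-cong e e′) (S.sym (×-distrib-+ u v p))

  -- By `prime∣C` only the two end terms of the binomial expansion survive modulo `p`. An explicit
  -- multiple `p · u` on one side states the congruence without subtraction.
  frobenius-+ : ∀ {p} → Prime p → ∀ x y → ∃[ u ] (x S.+ y) ^ p ≈ (x ^ p S.+ y ^ p) S.+ p · u
  frobenius-+ {zero} pp x y = ⊥-elim (¬prime[0] pp)
  frobenius-+ {p@(suc q)} pp x y = u , (begin
    (x S.+ y) ^ p                                  ≈⟨ theorem p x y ⟩
    binomialExpansion x y p                        ≈⟨ S.+-congˡ (sum-init-last (λ i → binomialTerm x y p (suc i))) ⟩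
    binomialTerm x y p zero S.+ (sum mid S.+ lst)  ≈⟨ S.+-cong fst≈ (S.+-cong sum≈ lst≈) ⟩
    y ^ p S.+ (p · u S.+ x ^ p)                    ≈⟨ S.+-congˡ (S.+-comm _ _) ⟩
    y ^ p S.+ (x ^ p S.+ p · u)                    ≈⟨ S.+-assoc _ _ _ ⟨
    (y ^ p S.+ x ^ p) S.+ p · u                    ≈⟨ S.+-congʳ (S.+-comm _ _) ⟩
    (x ^ p S.+ y ^ p) S.+ p · u                    ∎)
    where
    open Binomial S
    mid : Fin q → Carrier
    mid i = binomialTerm x y p (suc (inject₁ i))

    mid-multiple : ∀ i → ∃[ u ] mid i ≈ p · u
    mid-multiple i
      with prime∣C pp (suc (toℕ (inject₁ i))) z<s (s≤s (subst (_< q) (sym (Fin.toℕ-inject₁ i)) (Fin.toℕ<n i)))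
    ... | divides c eq = c · b , S.trans (×-congˡ {b} eq′) (S.sym (×-assocˡ b p c))
      where
      b = binomial x y p (suc (inject₁ i))
      eq′ = trans eq (ℕ.*-comm c p)

    u = proj₁ (sum-·-multiple p mid mid-multiple)
    sum≈ = proj₂ (sum-·-multiple p mid mid-multiple)
    lst = binomialTerm x y p (suc (fromℕ q))

    fst≈ : binomialTerm x y p zero ≈ y ^ p
    fst≈ = S.trans (×-homo-1 _) (S.*-identityˡ _)

    lst≈ : lst ≈ x ^ p
    lst≈ rewrite Fin.toℕ-fromℕ q | nCn≡1 p | ℕ.n∸n≡0 q = S.trans (×-homo-1 _) (S.*-identityʳ _)

  frobenius-sum : ∀ {p} → Prime p → ∀ xs →
    ∃[ u ] foldr S._+_ S.0# xs ^ p ≈ foldr S._+_ S.0# (map (_^ p) xs) S.+ p · u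
  frobenius-sum {zero} pp _ = ⊥-elim (¬prime[0] pp)
  frobenius-sum {p@(suc _)} pp [] = S.0# , S.trans (S.zeroˡ _) (S.sym (S.trans (S.+-identityˡ _) (p·0≈0)))
    where
    p·0≈0 : p · S.0# ≈ S.0#
    p·0≈0 = S.sym (proj₂ (sum-·-multiple p {zero} (λ ()) (λ ())))
  frobenius-sum {p} pp (x ∷ xs) with frobenius-+ pp x (foldr S._+_ S.0# xs) | frobenius-sum pp xs
  ... | u , e | v , e′ = _ , (begin
    (x S.+ _) ^ p                               ≈⟨ e ⟩
    (x ^ p S.+ _ ^ p) S.+ p · u                 ≈⟨ S.+-congʳ (S.+-congˡ e′) ⟩
    (x ^ p S.+ (_ S.+ p · v)) S.+ p · u         ≈⟨ S.+-congʳ (S.+-assoc _ _ _) ⟨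
    ((x ^ p S.+ _) S.+ p · v) S.+ p · u         ≈⟨ S.+-assoc _ _ _ ⟩
    (x ^ p S.+ _) S.+ (p · v S.+ p · u)         ≈⟨ S.+-congˡ (S.sym (×-distrib-+ v u p)) ⟩
    _ S.+ p · _                                 ∎)

-- The commutative semiring of shift operators

-- Formal expressions in the shifts: additivity and commutativity are then provable by induction on the
-- expression, instead of having to be carried along with each operator.
data Operator : Set where
  shift   : ℕ → ℕ → Operator
  𝟘       : Operator
  _⊕_ _⊗_ : Operator → Operator → Operator

⟦_⟧ : Operator → (ℕ → ℕ → ℤ) → ℕ → ℕ → ℤ
⟦ shift a b ⟧ f x y = f (a ℕ.+ x) (b ℕ.+ y)
⟦ 𝟘 ⟧         f x y = 0ℤ
⟦ s ⊕ t ⟧     f x y = ⟦ s ⟧ f x y + ⟦ t ⟧ f x y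
⟦ s ⊗ t ⟧     f     = ⟦ s ⟧ (⟦ t ⟧ f)

⟦⟧-cong : ∀ s {f g} → (∀ x y → f x y ≡ g x y) → ∀ x y → ⟦ s ⟧ f x y ≡ ⟦ s ⟧ g x y
⟦⟧-cong (shift a b) e x y = e _ _
⟦⟧-cong 𝟘           e x y = refl
⟦⟧-cong (s ⊕ t)     e x y = cong₂ _+_ (⟦⟧-cong s e x y) (⟦⟧-cong t e x y)
⟦⟧-cong (s ⊗ t)     e x y = ⟦⟧-cong s (⟦⟧-cong t e) x y

⟦⟧-+ : ∀ s f g x y → ⟦ s ⟧ (λ x y → f x y + g x y) x y ≡ ⟦ s ⟧ f x y + ⟦ s ⟧ g x y
⟦⟧-+ (shift a b) f g x y = refl
⟦⟧-+ 𝟘           f g x y = refl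
⟦⟧-+ (s ⊕ t)     f g x y =
  trans (cong₂ _+_ (⟦⟧-+ s f g x y) (⟦⟧-+ t f g x y))
        (interchange (⟦ s ⟧ f x y) (⟦ s ⟧ g x y) (⟦ t ⟧ f x y) (⟦ t ⟧ g x y))
  where
  interchange : ∀ a b c d → (a + b) + (c + d) ≡ (a + c) + (b + d)
  interchange = solve-∀
⟦⟧-+ (s ⊗ t)     f g x y =
  trans (⟦⟧-cong s (⟦⟧-+ t f g) x y) (⟦⟧-+ s (⟦ t ⟧ f) (⟦ t ⟧ g) x y)

⟦⟧-0 : ∀ s x y → ⟦ s ⟧ (λ _ _ → 0ℤ) x y ≡ 0ℤ
⟦⟧-0 (shift a b) x y = refl
⟦⟧-0 𝟘           x y = refl
⟦⟧-0 (s ⊕ t)     x y = cong₂ _+_ (⟦⟧-0 s x y) (⟦⟧-0 t x y)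
⟦⟧-0 (s ⊗ t)     x y = trans (⟦⟧-cong s (⟦⟧-0 t) x y) (⟦⟧-0 s x y)

-- Base case of `⊗-comm`: operators are built from translations, and these commute because addition
-- on `ℕ` does.
⟦⟧-shift : ∀ s a b f x y → ⟦ s ⟧ (⟦ shift a b ⟧ f) x y ≡ ⟦ s ⟧ f (a ℕ.+ x) (b ℕ.+ y)
⟦⟧-shift (shift c d) a b f x y = cong₂ f (m+[n+o]≡n+[m+o] a c x) (m+[n+o]≡n+[m+o] b d y)
⟦⟧-shift 𝟘           a b f x y = refl
⟦⟧-shift (s ⊕ t)     a b f x y = cong₂ _+_ (⟦⟧-shift s a b f x y) (⟦⟧-shift t a b f x y)
⟦⟧-shift (s ⊗ t)     a b f x y =
  trans (⟦⟧-cong s (⟦⟧-shift t a b f) x y) (⟦⟧-shift s a b (⟦ t ⟧ f) x y)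

⊗-comm : ∀ s t f x y → ⟦ s ⊗ t ⟧ f x y ≡ ⟦ t ⊗ s ⟧ f x y
⊗-comm s (shift a b) f x y = ⟦⟧-shift s a b f x y
⊗-comm s 𝟘           f x y = ⟦⟧-0 s x y
⊗-comm s (t ⊕ u)     f x y =
  trans (⟦⟧-+ s (⟦ t ⟧ f) (⟦ u ⟧ f) x y) (cong₂ _+_ (⊗-comm s t f x y) (⊗-comm s u f x y))
⊗-comm s (t ⊗ u)     f x y =
  trans (⊗-comm s t (⟦ u ⟧ f) x y) (⟦⟧-cong t (⊗-comm s u f) x y)

infix 4 _≋_
-- The semiring laws fail for the expressions themselves; they hold for their actions, compared
-- pointwise.
_≋_ : Operator → Operator → Set
s ≋ t = ∀ f x y → ⟦ s ⟧ f x y ≡ ⟦ t ⟧ f x y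

operators : CommutativeSemiring 0ℓ 0ℓ
operators = record
  { Carrier = Operator ; _≈_ = _≋_ ; _+_ = _⊕_ ; _*_ = _⊗_ ; 0# = 𝟘 ; 1# = shift 0 0
  ; isCommutativeSemiring = record
    { isSemiring = record
      { isSemiringWithoutAnnihilatingZero = record
        { +-isCommutativeMonoid = record
          { isMonoid = record
            { isSemigroup = record
              { isMagma = record
                { isEquivalence = record
                  { refl  = λ f x y → refl
                  ; sym   = λ e f x y → sym (e f x y)
                  ; trans = λ e e′ f x y → trans (e f x y) (e′ f x y)
                  }
                ; ∙-cong = λ e e′ f x y → cong₂ _+_ (e f x y) (e′ f x y)
                }
              ; assoc = λ s t u f x y → ℤ.+-assoc (⟦ s ⟧ f x y) _ _
              }
            ; identity = (λ s f x y → ℤ.+-identityˡ _) , (λ s f x y → ℤ.+-identityʳ _)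
            }
          ; comm = λ s t f x y → ℤ.+-comm (⟦ s ⟧ f x y) _
          }
        ; *-cong = λ {s} {s′} {t} {t′} e e′ f x y → trans (⟦⟧-cong s (e′ f) x y) (e (⟦ t′ ⟧ f) x y)
        ; *-assoc = λ s t u f x y → refl
        ; *-identity = (λ s f x y → refl) , (λ s f x y → refl)
        ; distrib = (λ s t u f x y → ⟦⟧-+ s (⟦ t ⟧ f) (⟦ u ⟧ f) x y) , (λ s t u f x y → refl)
        }
      ; zero = (λ s f x y → refl) , (λ s f x y → ⟦⟧-0 s x y)
      }
    ; *-comm = ⊗-comm
    }
  }

private
  module Op = CommutativeSemiring operators
open Exp Op.semiring using (_^_)
open Mult Op.semiring using () renaming (_×_ to _·_)

shift-^ : ∀ a b n → shift a b ^ n ≋ shift (n ℕ.* a) (n ℕ.* b)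
shift-^ a b zero    f x y = refl
shift-^ a b (suc n) f x y =
  trans (shift-^ a b n f (a ℕ.+ x) (b ℕ.+ y)) (cong₂ f (+-rotate a n x) (+-rotate b n y))
  where
  +-rotate : ∀ a n x → n ℕ.* a ℕ.+ (a ℕ.+ x) ≡ a ℕ.+ n ℕ.* a ℕ.+ x
  +-rotate a n x = trans (sym (ℕ.+-assoc (n ℕ.* a) a x)) (cong (ℕ._+ x) (ℕ.+-comm (n ℕ.* a) a))

⟦·⟧ : ∀ n s f x y → ⟦ n · s ⟧ f x y ≡ + n * ⟦ s ⟧ f x y
⟦·⟧ zero    s f x y = refl
⟦·⟧ (suc n) s f x y = trans (cong (_+_ (⟦ s ⟧ f x y)) (⟦·⟧ n s f x y)) (sym (ℤ.suc-* (+ n) _))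

⟦^⟧-annihilates : ∀ s n .{{_ : ℕ.NonZero n}} {f} → (∀ x y → ⟦ s ⟧ f x y ≡ 0ℤ) → ∀ x y → ⟦ s ^ n ⟧ f x y ≡ 0ℤ
-- In `s ^ suc n` the factor `s` acts last; commutativity lets it act on `f` first.
⟦^⟧-annihilates s (suc n) {f} e x y =
  trans (⊗-comm s (s ^ n) f x y) (trans (⟦⟧-cong (s ^ n) e x y) (⟦⟧-0 (s ^ n) x y))

-- Dilation of balanced stencils

dilate : ℕ → ℕ × ℕ → Operator
dilate r (a , b) = shift (r ℕ.* a) (r ℕ.* b)

-- The polynomial `∑ Xᵃ Yᵇ` over the offsets `(a , b)`, with `X` and `Y` replaced by `Xʳ` and `Yʳ`.
stencil : List (ℕ × ℕ) → ℕ → Operator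
stencil ws r = foldr _⊕_ 𝟘 (map (dilate r) ws)

stencil-bound : ∀ ws r B {f} → (∀ x y → ∣ f x y ∣ ≤ B) → ∀ x y → ∣ ⟦ stencil ws r ⟧ f x y ∣ ≤ length ws ℕ.* B
stencil-bound []       r B bd x y = z≤n
stencil-bound (w ∷ ws) r B {f} bd x y =
  ℕ.≤-trans (ℤ.∣i+j∣≤∣i∣+∣j∣ (⟦ dilate r w ⟧ f x y) _) (ℕ.+-mono-≤ (bd _ _) (stencil-bound ws r B {f} bd x y))

-- The p-th power of a stencil is its dilation by p up to a multiple of p, and the bound turns
-- "divisible by p" into "zero".
stencil-dilate : ∀ {ws B f p} → Prime p → length ws ℕ.* B < p → (∀ x y → ∣ f x y ∣ ≤ B) →
  ∀ r → (∀ x y → ⟦ stencil ws r ⟧ f x y ≡ 0ℤ) → ∀ x y → ⟦ stencil ws (p ℕ.* r) ⟧ f x y ≡ 0ℤ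
stencil-dilate {ws} {B} {f} {p} pp <p bd r e x y with frobenius-sum operators pp (map (dilate r) ws)
... | u , e′ = ℤ.∣i∣≡0⇒i≡0 (small (divides ∣ v ∣ ∣z∣≡) (ℕ.≤-<-trans (stencil-bound ws (p ℕ.* r) B {f} bd x y) <p))
  where
  instance _ = prime⇒nonZero pp
  z = ⟦ stencil ws (p ℕ.* r) ⟧ f x y
  v = ⟦ u ⟧ f x y

  powers : ∀ ws → ⟦ foldr _⊕_ 𝟘 (map (_^ p) (map (dilate r) ws)) ⟧ f x y ≡ ⟦ stencil ws (p ℕ.* r) ⟧ f x y
  powers []             = refl
  powers ((a , b) ∷ ws) = cong₂ _+_
    (trans (shift-^ (r ℕ.* a) (r ℕ.* b) p f x y)
           (cong₂ (λ a b → f (a ℕ.+ x) (b ℕ.+ y)) (sym (ℕ.*-assoc p r a)) (sym (ℕ.*-assoc p r b))))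
    (powers ws)

  z+pv≡0 : z + + p * v ≡ 0ℤ
  z+pv≡0 = begin
    z + + p * v
      ≡⟨ cong₂ _+_ (powers ws) (⟦·⟧ p u f x y) ⟨
    ⟦ foldr _⊕_ 𝟘 (map (_^ p) (map (dilate r) ws)) ⟧ f x y + ⟦ p · u ⟧ f x y
      ≡⟨ e′ f x y ⟨
    ⟦ stencil ws r ^ p ⟧ f x y
      ≡⟨ ⟦^⟧-annihilates (stencil ws r) p e x y ⟩
    0ℤ ∎
    where open ≡-Reasoning

  ∣z∣≡ : ∣ z ∣ ≡ ∣ v ∣ ℕ.* p
  ∣z∣≡ = begin
    ∣ z ∣             ≡⟨ cong ∣_∣ (ℤ.i-j≡0⇒i≡j z (- (+ p * v)) (trans (cong (_+_ z) (ℤ.neg-involutive _)) z+pv≡0)) ⟩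
    ∣ - (+ p * v) ∣   ≡⟨ ℤ.∣-i∣≡∣i∣ (+ p * v) ⟩
    ∣ + p * v ∣       ≡⟨ ℤ.abs-* (+ p) v ⟩
    p ℕ.* ∣ v ∣       ≡⟨ ℕ.*-comm p ∣ v ∣ ⟩
    ∣ v ∣ ℕ.* p       ∎
    where open ≡-Reasoning

  small : ∀ {n} → p ∣ n → n < p → n ≡ 0
  small {zero}  _   _   = refl
  small {suc n} p∣n n<p = ⊥-elim (>⇒∤ n<p p∣n)

-- The primes are absorbed one at a time. The bound concerns `f` itself, so the same threshold
-- serves at every stage.
stencil-dilate-product : ∀ {ws B f} → (∀ x y → ∣ f x y ∣ ≤ B) → (∀ x y → ⟦ stencil ws 1 ⟧ f x y ≡ 0ℤ) →
  ∀ {ps} → All (λ p → Prime p × length ws ℕ.* B < p) ps → ∀ x y → ⟦ stencil ws (product ps) ⟧ f x y ≡ 0ℤ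
stencil-dilate-product bd e []                 = e
stencil-dilate-product {ws} bd e {p ∷ ps} ((pp , <p) ∷ h) =
  stencil-dilate {ws} pp <p bd (product ps) (stencil-dilate-product {ws} bd e h)

stencil-dilate-rough : ∀ {ws B f} → (∀ x y → ∣ f x y ∣ ≤ B) → (∀ x y → ⟦ stencil ws 1 ⟧ f x y ≡ 0ℤ) →
  ∀ r .{{_ : ℕ.NonZero r}} → (∀ p → Prime p → p ∣ r → length ws ℕ.* B < p) →
  ∀ x y → ⟦ stencil ws r ⟧ f x y ≡ 0ℤ
stencil-dilate-rough {ws} {B} {f} bd e r rough =
  subst (λ r → ∀ x y → ⟦ stencil ws r ⟧ f x y ≡ 0ℤ) (sym isFactorisation)
    (stencil-dilate-product {ws} bd e (large factors factorsPrime (λ d → subst (_ ∣_) (sym isFactorisation) d)))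
  where
  open PrimeFactorisation (factorise r)
  large : ∀ ps → All Prime ps → (∀ {p} → p ∣ product ps → p ∣ r) → All (λ p → Prime p × length ws ℕ.* B < p) ps
  large []       []         _ = []
  large (p ∷ ps) (pp ∷ pps) d =
    (pp , rough p pp (d (m∣m*n (product ps)))) ∷ large ps pps (λ h → d (∣-trans h (n∣m*n p)))

-- Signs and parity

torsion-free : ∀ n .{{_ : ℕ.NonZero n}} {z} → + n * z ≡ 0ℤ → z ≡ 0ℤ
torsion-free (suc n) {z} e = ℤ.*-cancelˡ-≡ (+ suc n) z 0ℤ (trans e (sym (ℤ.*-zeroʳ (+ suc n))))

-- The sign `(-1)ⁿ`; it also serves to express parity.
alt : ℕ → ℤ
alt zero    = 1ℤ
alt (suc n) = - alt n

alt-+ : ∀ m n → alt (m ℕ.+ n) ≡ alt m * alt n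
alt-+ zero    n = sym (ℤ.*-identityˡ (alt n))
alt-+ (suc m) n = trans (cong -_ (alt-+ m n)) (ℤ.neg-distribˡ-* (alt m) (alt n))

alt-*-even : ∀ {k} → alt k ≡ 1ℤ → ∀ n → alt (n ℕ.* k) ≡ 1ℤ
alt-*-even     e zero    = refl
alt-*-even {k} e (suc n) = trans (alt-+ k (n ℕ.* k)) (cong₂ _*_ e (alt-*-even {k} e n))

alt-*-odd : ∀ {k} → alt k ≡ -1ℤ → ∀ n → alt (n ℕ.* k) ≡ alt n
alt-*-odd     e zero    = refl
alt-*-odd {k} e (suc n) =
  trans (alt-+ k (n ℕ.* k)) (trans (cong₂ _*_ e (alt-*-odd {k} e n)) (ℤ.-1*i≡-i (alt n)))

parity : ∀ n → (∃[ i ] n ≡ i ℕ.* 2) ⊎ (∃[ i ] n ≡ 1 ℕ.+ i ℕ.* 2)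
parity zero = inj₁ (0 , refl)
parity (suc n) with parity n
... | inj₁ (i , refl) = inj₂ (i , refl)
... | inj₂ (i , refl) = inj₁ (suc i , refl)

alt-even : ∀ i → alt (i ℕ.* 2) ≡ 1ℤ
alt-even = alt-*-even {2} refl

alt-cases : ∀ n → (alt n ≡ 1ℤ × (2 ∣ n)) ⊎ alt n ≡ -1ℤ
alt-cases n with parity n
... | inj₁ (i , refl) = inj₁ (alt-even i , n∣m*n i)
... | inj₂ (i , refl) = inj₂ (cong -_ (alt-even i))

1≢-1 : 1ℤ ≢ -1ℤ
1≢-1 ()

alt≢0 : ∀ n → alt n ≢ 0ℤ
alt≢0 (suc n) e = alt≢0 n (ℤ.neg-injective e)

-- `1 · 3 · … · (2b - 1)`, an odd number divisible by every odd prime up to `b`.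
oddProduct : ℕ → ℕ
oddProduct zero    = 1
oddProduct (suc b) = (1 ℕ.+ b ℕ.* 2) ℕ.* oddProduct b

alt-oddProduct : ∀ b → alt (oddProduct b) ≡ -1ℤ
alt-oddProduct zero    = refl
alt-oddProduct (suc b) =
  trans (alt-*-odd {oddProduct b} (alt-oddProduct b) (1 ℕ.+ b ℕ.* 2)) (cong -_ (alt-even b))

odd∣oddProduct : ∀ {i b} → i < b → 1 ℕ.+ i ℕ.* 2 ∣ oddProduct b
odd∣oddProduct {i} {suc b} (s≤s i≤b) with ℕ.m≤n⇒m<n∨m≡n i≤b
... | inj₁ i<b  = ∣-trans (odd∣oddProduct i<b) (n∣m*n (1 ℕ.+ b ℕ.* 2))
... | inj₂ refl = m∣m*n (oddProduct b)

-- An odd prime `p ≤ b` would divide `oddProduct b`, hence `K`, hence `c ≤ 2`, which is impossible;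
-- `p = 2` is excluded because `K + c` is odd.
prime-divisor-large : ∀ b K c .{{_ : ℕ.NonZero c}} → c ≤ 2 → oddProduct b ∣ K → alt (K ℕ.+ c) ≡ -1ℤ →
  ∀ p → Prime p → p ∣ K ℕ.+ c → b < p
prime-divisor-large b K c c≤2 Q∣K odd p pp p∣ with b ℕ.<? p | parity p
... | yes b<p | _ = b<p
... | no _ | inj₁ (i , refl) with p∣
...   | divides q eq = ⊥-elim (1≢-1 (trans (sym (alt-*-even {i ℕ.* 2} (alt-even i) q)) (trans (cong alt (sym eq)) odd)))
prime-divisor-large b K c c≤2 Q∣K odd p pp p∣ | no b≮p | inj₂ (zero  , refl) = ⊥-elim (¬prime[1] pp)
prime-divisor-large b K c c≤2 Q∣K odd p pp p∣ | no b≮p | inj₂ (suc i , refl) =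
  ⊥-elim (ℕ.<⇒≱ (s≤s (s≤s z<s)) (ℕ.≤-trans (∣⇒≤ (∣m+n∣m⇒∣n p∣ (∣-trans (odd∣oddProduct i<b) Q∣K))) c≤2))
  where
  i<b : suc i < b
  i<b = ℕ.<-≤-trans (s≤s (s≤s (ℕ.≤-trans (ℕ.m≤m*n i 2) (ℕ.n≤1+n _)))) (ℕ.≮⇒≥ b≮p)

-- The quotients of `N` and `M` by their gcd are coprime, so they cannot both be even.
common-multiple : ∀ M N .{{_ : ℕ.NonZero M}} → ∃[ s ] ∃[ t ] (s ℕ.* M ≡ t ℕ.* N × ¬ ((2 ∣ s) × (2 ∣ t)))
common-multiple M N = N ℕ./ g , M ℕ./ g , eq , λ (2∣s , 2∣t) → case (coprime-/gcd M N (2∣t , 2∣s))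
  where
  g = gcd M N
  instance _ = ℕ.≢-nonZero (gcd[m,n]≢0 M N (inj₁ (ℕ.≢-nonZero⁻¹ M)))
  case : 2 ≢ 1
  case ()
  eq : N ℕ./ g ℕ.* M ≡ M ℕ./ g ℕ.* N
  eq = begin
    N ℕ./ g ℕ.* M                      ≡⟨ cong (N ℕ./ g ℕ.*_) (m/n*n≡m (gcd[m,n]∣m M N)) ⟨
    N ℕ./ g ℕ.* (M ℕ./ g ℕ.* g)        ≡⟨ cong (N ℕ./ g ℕ.*_) (ℕ.*-comm (M ℕ./ g) g) ⟩
    N ℕ./ g ℕ.* (g ℕ.* (M ℕ./ g))      ≡⟨ ℕ.*-assoc (N ℕ./ g) g (M ℕ./ g) ⟨
    N ℕ./ g ℕ.* g ℕ.* (M ℕ./ g)        ≡⟨ cong (ℕ._* (M ℕ./ g)) (m/n*n≡m (gcd[m,n]∣n M N)) ⟩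
    N ℕ.* (M ℕ./ g)                    ≡⟨ ℕ.*-comm N (M ℕ./ g) ⟩
    M ℕ./ g ℕ.* N                      ∎
    where open ≡-Reasoning

-- Antiperiodic functions

Antiperiodic : ℕ → (ℕ → ℤ) → Set
Antiperiodic M h = ∀ x → h (M ℕ.+ x) ≡ - h x

antiperiodic-multiple : ∀ {M h} → Antiperiodic M h → ∀ k x → h (k ℕ.* M ℕ.+ x) ≡ alt k * h x
antiperiodic-multiple         anti zero    x = sym (ℤ.*-identityˡ _)
antiperiodic-multiple {M} {h} anti (suc k) x = begin
  h (M ℕ.+ k ℕ.* M ℕ.+ x)    ≡⟨ cong h (ℕ.+-assoc M (k ℕ.* M) x) ⟩
  h (M ℕ.+ (k ℕ.* M ℕ.+ x))  ≡⟨ anti _ ⟩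
  - h (k ℕ.* M ℕ.+ x)        ≡⟨ cong -_ (antiperiodic-multiple anti k x) ⟩
  - (alt k * h x)            ≡⟨ ℤ.neg-distribˡ-* (alt k) (h x) ⟩
  - alt k * h x              ∎
  where open ≡-Reasoning

-- Stencil equations only reach arguments from some offset `k` on. A smaller argument is moved up by
-- one period, at the cost of a sign.
antiperiodic-vanish : ∀ {M h} k → Antiperiodic (suc M) h → (∀ x → h (k ℕ.+ x) ≡ 0ℤ) → ∀ x → h x ≡ 0ℤ
antiperiodic-vanish         zero    anti e = e
antiperiodic-vanish {M} {h} (suc k) anti e = antiperiodic-vanish k anti λ x →
  ℤ.neg-injective (trans (sym (anti (k ℕ.+ x))) (trans (cong h (cong suc (m+[n+o]≡n+[m+o] M k x))) (e (M ℕ.+ x))))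

-- From `1 + X + X² = 0` follows `X³ = 1`, so translation by `3 M` fixes `h`, while antiperiodicity
-- makes it negate `h`.
three-term-vanish : ∀ {M h} → Antiperiodic M h → (∀ x → h (2 ℕ.+ x) + h (1 ℕ.+ x) + h x ≡ 0ℤ) → ∀ x → h x ≡ 0ℤ
three-term-vanish {M} {h} anti e x = torsion-free 2 (begin
  + 2 * h x
    ≡⟨ double (h x) ⟩
  h x - (- h x)
    ≡⟨ cong₂ _-_ (period³ M) (trans (antiperiodic-multiple anti 3 x) (ℤ.-1*i≡-i (h x))) ⟨
  h (M ℕ.* 3 ℕ.+ x) - h (3 ℕ.* M ℕ.+ x)
    ≡⟨ cong (λ k → h (M ℕ.* 3 ℕ.+ x) - h (k ℕ.+ x)) (ℕ.*-comm 3 M) ⟩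
  h (M ℕ.* 3 ℕ.+ x) - h (M ℕ.* 3 ℕ.+ x)
    ≡⟨ ℤ.+-inverseʳ (h (M ℕ.* 3 ℕ.+ x)) ⟩
  0ℤ ∎)
  where
  open ≡-Reasoning
  double : ∀ z → + 2 * z ≡ z - (- z)
  double = solve-∀
  difference : ∀ a b c d → a - d ≡ (a + b + c) - (b + c + d)
  difference = solve-∀
  period : ∀ x → h (3 ℕ.+ x) ≡ h x
  period x = ℤ.i-j≡0⇒i≡j _ _ (trans (difference (h (3 ℕ.+ x)) (h (2 ℕ.+ x)) (h (1 ℕ.+ x)) (h x))
                                    (cong₂ _-_ (e (suc x)) (e x)))
  period³ : ∀ k → h (k ℕ.* 3 ℕ.+ x) ≡ h x
  period³ zero    = refl
  period³ (suc k) = trans (period (k ℕ.* 3 ℕ.+ x)) (period³ k)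

-- The solutions of this recurrence that start with 0 are the multiples of (-1)ˣ x.
double-root-vanish : ∀ {m} {h : ℕ → ℤ} → h 0 ≡ 0ℤ → h (suc m) ≡ 0ℤ →
  (∀ x → h (2 ℕ.+ x) + + 2 * h (1 ℕ.+ x) + h x ≡ 0ℤ) → ∀ x → h x ≡ 0ℤ
double-root-vanish {m} {h} h0 hM e x = trans (closed x)
  (trans (cong (λ c → - (alt x * (+ x * c))) h1≡0) (zeros (alt x) (+ x)))
  where
  open ≡-Reasoning
  zeros : ∀ a b → - (a * (b * 0ℤ)) ≡ 0ℤ
  zeros = solve-∀
  step : ∀ a x c z → z + + 2 * (- (- a * ((1ℤ + x) * c))) + - (a * (x * c)) ≡ 0ℤ → z ≡ - (- - a * ((1ℤ + (1ℤ + x)) * c))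
  step a x c z eq = ℤ.i-j≡0⇒i≡j _ _ (trans (lemma a x c z) eq)
    where
    lemma : ∀ a x c z → z - (- (- - a * ((1ℤ + (1ℤ + x)) * c))) ≡ z + + 2 * (- (- a * ((1ℤ + x) * c))) + - (a * (x * c))
    lemma = solve-∀
  closed² : ∀ x → h x ≡ - (alt x * (+ x * h 1)) × h (suc x) ≡ - (alt (suc x) * (+ suc x * h 1))
  closed² zero    = h0 , lemma (h 1)
    where
    lemma : ∀ c → c ≡ - (-1ℤ * (1ℤ * c))
    lemma = solve-∀
  closed² (suc x) with closed² x
  ... | p , q = q , step (alt x) (+ x) (h 1) (h (2 ℕ.+ x)) (subst₂ (λ u v → h (2 ℕ.+ x) + + 2 * u + v ≡ 0ℤ) q p (e x))
  closed : ∀ x → h x ≡ - (alt x * (+ x * h 1))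
  closed x = proj₁ (closed² x)
  -- At the second zero the closed form reads `± (m + 1) * h 1 = 0`.
  h1≡0 : h 1 ≡ 0ℤ
  h1≡0 with ℤ.i*j≡0⇒i≡0∨j≡0 (alt (suc m)) (ℤ.neg-injective (trans (sym (closed (suc m))) hM))
  ... | inj₁ z = ⊥-elim (alt≢0 (suc m) z)
  ... | inj₂ z = torsion-free (suc m) z

-- Dilated neighbourhood sums with signs

alt-*-cross : ∀ k → alt (k ℕ.* 0) ≡ 1ℤ × alt (k ℕ.* 1) ≡ alt k × alt (k ℕ.* 2) ≡ 1ℤ
alt-*-cross k = cong alt (ℕ.*-zeroʳ k) , cong alt (ℕ.*-identityʳ k) , alt-even k

*2+ : ∀ c x → c ℕ.* 2 ℕ.+ x ≡ c ℕ.+ (c ℕ.+ x)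
*2+ c x = trans (cong (ℕ._+ x) (trans (ℕ.*-comm c 2) (cong (c ℕ.+_) (ℕ.+-identityʳ c)))) (ℕ.+-assoc c c x)

-- The closed neighbourhood of (1 , 1); centring it there keeps all offsets in ℕ.
neighbourhood : List (ℕ × ℕ)
neighbourhood = (1 , 1) ∷ (2 , 1) ∷ (0 , 1) ∷ (1 , 2) ∷ (1 , 0) ∷ []

-- What the neighbourhood sum dilated by K + c becomes when translation by K acts on the two
-- coordinates by the signs σ and τ; twice K then acts trivially.
twisted : ℕ → ℤ → ℤ → (ℕ → ℕ → ℤ) → ℕ → ℕ → ℤ
twisted c σ τ f x y =
  σ * τ * f (c ℕ.+ x) (c ℕ.+ y)
  + τ * (f (c ℕ.+ (c ℕ.+ x)) (c ℕ.+ y) + f x (c ℕ.+ y))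
  + σ * (f (c ℕ.+ x) (c ℕ.+ (c ℕ.+ y)) + f (c ℕ.+ x) y)

twisted-flip : ∀ c σ τ f x y → twisted c τ σ (flip f) x y ≡ twisted c σ τ f y x
twisted-flip c σ τ f x y = lemma σ τ (f (c ℕ.+ y) (c ℕ.+ x)) _ _
  where
  lemma : ∀ σ τ p a b → τ * σ * p + σ * a + τ * b ≡ σ * τ * p + τ * b + σ * a
  lemma = solve-∀

module _ {M N : ℕ} {f : ℕ → ℕ → ℤ}
  (antiˡ : ∀ y → Antiperiodic M (λ x → f x y))
  (antiʳ : ∀ x → Antiperiodic N (f x)) where

  -- `K` is a multiple of both periods, but the quotients `k` and `l` may differ in parity, so each
  -- coordinate carries its own sign.
  translate : ∀ {K c} k l → k ℕ.* M ≡ K → l ℕ.* N ≡ K → ∀ a b x y →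
    f ((K ℕ.+ c) ℕ.* a ℕ.+ x) ((K ℕ.+ c) ℕ.* b ℕ.+ y) ≡
    alt (k ℕ.* a) * (alt (l ℕ.* b) * f (c ℕ.* a ℕ.+ x) (c ℕ.* b ℕ.+ y))
  translate {K} {c} k l kM lN a b x y = begin
    f ((K ℕ.+ c) ℕ.* a ℕ.+ x) ((K ℕ.+ c) ℕ.* b ℕ.+ y)  ≡⟨ cong₂ f (split k M kM a x) (split l N lN b y) ⟩
    f (k ℕ.* a ℕ.* M ℕ.+ (c ℕ.* a ℕ.+ x)) (l ℕ.* b ℕ.* N ℕ.+ (c ℕ.* b ℕ.+ y))
      ≡⟨ antiperiodic-multiple (antiˡ _) (k ℕ.* a) _ ⟩
    alt (k ℕ.* a) * f (c ℕ.* a ℕ.+ x) (l ℕ.* b ℕ.* N ℕ.+ (c ℕ.* b ℕ.+ y))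
      ≡⟨ cong (alt (k ℕ.* a) *_) (antiperiodic-multiple (antiʳ _) (l ℕ.* b) _) ⟩
    alt (k ℕ.* a) * (alt (l ℕ.* b) * f (c ℕ.* a ℕ.+ x) (c ℕ.* b ℕ.+ y)) ∎
    where
    open ≡-Reasoning
    split : ∀ k M → k ℕ.* M ≡ K → ∀ a x → (K ℕ.+ c) ℕ.* a ℕ.+ x ≡ k ℕ.* a ℕ.* M ℕ.+ (c ℕ.* a ℕ.+ x)
    split k M refl a x = begin
      (k ℕ.* M ℕ.+ c) ℕ.* a ℕ.+ x             ≡⟨ cong (ℕ._+ x) (ℕ.*-distribʳ-+ a (k ℕ.* M) c) ⟩
      k ℕ.* M ℕ.* a ℕ.+ c ℕ.* a ℕ.+ x         ≡⟨ ℕ.+-assoc (k ℕ.* M ℕ.* a) (c ℕ.* a) x ⟩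
      k ℕ.* M ℕ.* a ℕ.+ (c ℕ.* a ℕ.+ x)       ≡⟨ cong (ℕ._+ (c ℕ.* a ℕ.+ x)) (m*n*o≡m*o*n k M a) ⟩
      k ℕ.* a ℕ.* M ℕ.+ (c ℕ.* a ℕ.+ x)       ∎

  -- An offset coordinate 1 contributes the sign `alt k` or `alt l`; the even coordinates 0 and 2
  -- contribute none. So the centre gets both signs, and each arm of the cross gets the sign of the
  -- coordinate along which it does not move.
  stencil-twisted : ∀ {K} c k l → k ℕ.* M ≡ K → l ℕ.* N ≡ K → ∀ x y →
    ⟦ stencil neighbourhood (K ℕ.+ c) ⟧ f x y ≡ twisted c (alt k) (alt l) f x y
  stencil-twisted {K} c k l kM lN x y
    with k0 , k1 , k2 ← alt-*-cross k | l0 , l1 , l2 ← alt-*-cross l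
    rewrite translate {K} {c} k l kM lN 1 1 x y | translate {K} {c} k l kM lN 2 1 x y
          | translate {K} {c} k l kM lN 0 1 x y | translate {K} {c} k l kM lN 1 2 x y
          | translate {K} {c} k l kM lN 1 0 x y
          | k0 | k1 | k2 | l0 | l1 | l2
          | *2+ c x | *2+ c y | ℕ.*-identityʳ c | ℕ.*-zeroʳ c
    = lemma (alt k) (alt l) _ _ _ _ _
    where
    lemma : ∀ σ τ p a b d e →
      σ * (τ * p) + (1ℤ * (τ * a) + (1ℤ * (τ * b) + (σ * (1ℤ * d) + (σ * (1ℤ * e) + 0ℤ)))) ≡
      σ * τ * p + τ * (a + b) + σ * (d + e)
    lemma = solve-∀

-- Vanishing from two neighbourhood equations

module _ {m n : ℕ} {f : ℕ → ℕ → ℤ}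
  (antiˡ : ∀ y → Antiperiodic (suc m) (λ x → f x y))
  (antiʳ : ∀ x → Antiperiodic (suc n) (f x))
  (balanced : ∀ x y → twisted 1 1ℤ 1ℤ f x y ≡ 0ℤ) where

  -- With both signs -1 the centre keeps its sign and the four neighbours change theirs; adding the
  -- balance equation leaves twice the centre.
  both-vanish : (∀ x y → twisted 1 -1ℤ -1ℤ f x y ≡ 0ℤ) → ∀ x y → f x y ≡ 0ℤ
  both-vanish e x y = antiperiodic-vanish 1 (antiˡ y) (λ x → antiperiodic-vanish 1 (antiʳ (suc x)) (λ y →
    torsion-free 2 (trans (lemma (f (suc x) (suc y)) _ _) (cong₂ _+_ (balanced x y) (e x y)))) y) x
    where
    lemma : ∀ p a b → + 2 * p ≡
      (1ℤ * 1ℤ * p + 1ℤ * a + 1ℤ * b) + (-1ℤ * -1ℤ * p + -1ℤ * a + -1ℤ * b)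
    lemma = solve-∀

  -- Subtracting the two equations cancels the neighbours in the first coordinate and leaves twice a
  -- sum of three consecutive values in the second.
  left-vanish : (∀ x y → twisted 1 -1ℤ 1ℤ f x y ≡ 0ℤ) → ∀ x y → f x y ≡ 0ℤ
  left-vanish e x y = antiperiodic-vanish 1 (antiˡ y) (λ x → three-term-vanish (antiʳ (suc x)) (λ y →
    torsion-free 2 (trans (lemma (f (suc x) (suc y)) _ (f (suc x) (2 ℕ.+ y)) (f (suc x) y))
                           (cong₂ _-_ (balanced x y) (e x y)))) y) x
    where
    lemma : ∀ p a c d → + 2 * (c + p + d) ≡
      (1ℤ * 1ℤ * p + 1ℤ * a + 1ℤ * (c + d)) - (-1ℤ * 1ℤ * p + 1ℤ * a + -1ℤ * (c + d))
    lemma = solve-∀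

  -- With a = X + X⁻¹ and b = Y + Y⁻¹ for the two shifts, 1 + a + b = 0 and the odd condition
  -- 1 - (a² - 2) - (b² - 2) = 0 give (a + 2)(a - 1) = 0.
  odd-equation : (∀ x y → twisted 2 -1ℤ -1ℤ f x y ≡ 0ℤ) → (∀ y → f 1 y ≡ f m y) → (∀ y → f 0 y ≡ 0ℤ) →
    ∀ x y → f (1 ℕ.+ x) (2 ℕ.+ y) ≡ f (2 ℕ.+ x) (2 ℕ.+ y) + f x (2 ℕ.+ y)
  odd-equation e edge zero-edge x y =
    ℤ.i-j≡0⇒i≡j _ _ (antiperiodic-vanish {h = g} m g-anti (double-root-vanish {m} g0 gM shifted-recurrence) x)
    where
    g : ℕ → ℤ
    g x = f (1 ℕ.+ x) (2 ℕ.+ y) - (f (2 ℕ.+ x) (2 ℕ.+ y) + f x (2 ℕ.+ y))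

    shift-anti : ∀ k x → f (k ℕ.+ (suc m ℕ.+ x)) (2 ℕ.+ y) ≡ - f (k ℕ.+ x) (2 ℕ.+ y)
    shift-anti k x = trans (cong (λ z → f z (2 ℕ.+ y)) (m+[n+o]≡n+[m+o] k (suc m) x)) (antiˡ _ (k ℕ.+ x))

    g-anti : Antiperiodic (suc m) g
    g-anti x rewrite shift-anti 1 x | shift-anti 2 x | shift-anti 0 x =
      lemma (f (1 ℕ.+ x) (2 ℕ.+ y)) (f (2 ℕ.+ x) (2 ℕ.+ y)) (f x (2 ℕ.+ y))
      where
      lemma : ∀ a b c → - a - (- b + - c) ≡ - (a - (b + c))
      lemma = solve-∀

    -- `g x` is centred at `x + 1`, so `g m` is centred on the line `m + 1`, where `f` vanishes; its
    -- neighbours there are `- f 1 = - f m` and `f m`.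
    g0 : g (m ℕ.+ 0) ≡ 0ℤ
    g0 rewrite antiˡ (2 ℕ.+ y) 0 | trans (cong (λ k → f (suc k) (2 ℕ.+ y)) (sym (ℕ.+-suc m 0))) (antiˡ (2 ℕ.+ y) 1)
             | zero-edge (2 ℕ.+ y) | ℕ.+-identityʳ m | edge (2 ℕ.+ y) = lemma (f m (2 ℕ.+ y))
      where
      lemma : ∀ a → 0ℤ - (- a + a) ≡ 0ℤ
      lemma = solve-∀

    gM : g (m ℕ.+ suc m) ≡ 0ℤ
    gM = trans (cong g (trans (ℕ.+-suc m m) (cong (suc m ℕ.+_) (sym (ℕ.+-identityʳ m)))))
               (trans (g-anti (m ℕ.+ 0)) (cong -_ g0))

    -- Since `g` is `(1 - a) f`, this is `(a + 2)(1 - a) f = 0`. The certificate is `2 (a + 2)(1 -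
    -- a) = (5 - a² - b²) + (b - (1 + a))(1 + a + b)`, applied at `(x + 2 , y +
    -- 2)`; the five uses of `balanced` are the terms of the last product.
    g-recurrence : ∀ x → g (2 ℕ.+ x) + + 2 * g (1 ℕ.+ x) + g x ≡ 0ℤ
    g-recurrence x = torsion-free 2 (trans
      (lemma (f x y) (f (1 ℕ.+ x) y) (f (2 ℕ.+ x) y)
             (f x (1 ℕ.+ y)) (f (1 ℕ.+ x) (1 ℕ.+ y)) (f (2 ℕ.+ x) (1 ℕ.+ y)) (f (3 ℕ.+ x) (1 ℕ.+ y))
             (f x (2 ℕ.+ y)) (f (1 ℕ.+ x) (2 ℕ.+ y)) (f (2 ℕ.+ x) (2 ℕ.+ y)) (f (3 ℕ.+ x) (2 ℕ.+ y))
             (f (4 ℕ.+ x) (2 ℕ.+ y))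
             (f (1 ℕ.+ x) (3 ℕ.+ y)) (f (2 ℕ.+ x) (3 ℕ.+ y)) (f (3 ℕ.+ x) (3 ℕ.+ y)) (f (2 ℕ.+ x) (4 ℕ.+ y)))
      (cong₂ _+_ (e x y) (cong₂ _-_ (cong₂ _+_ (balanced (1 ℕ.+ x) (2 ℕ.+ y)) (balanced (1 ℕ.+ x) y))
         (cong₂ _+_ (cong₂ _+_ (balanced (1 ℕ.+ x) (1 ℕ.+ y)) (balanced (2 ℕ.+ x) (1 ℕ.+ y))) (balanced x (1 ℕ.+ y))))))
      where
      lemma : ∀ f00 f10 f20 f01 f11 f21 f31 f02 f12 f22 f32 f42 f13 f23 f33 f24 →
        + 2 * ((f32 - (f42 + f22)) + + 2 * (f22 - (f32 + f12)) + (f12 - (f22 + f02))) ≡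
        (-1ℤ * -1ℤ * f22 + -1ℤ * (f42 + f02) + -1ℤ * (f24 + f20))
        + (((1ℤ * 1ℤ * f23 + 1ℤ * (f33 + f13) + 1ℤ * (f24 + f22))
            + (1ℤ * 1ℤ * f21 + 1ℤ * (f31 + f11) + 1ℤ * (f22 + f20)))
           - (((1ℤ * 1ℤ * f22 + 1ℤ * (f32 + f12) + 1ℤ * (f23 + f21))
               + (1ℤ * 1ℤ * f32 + 1ℤ * (f42 + f22) + 1ℤ * (f33 + f31)))
              + (1ℤ * 1ℤ * f12 + 1ℤ * (f22 + f02) + 1ℤ * (f13 + f11))))
      lemma = solve-∀

    -- The recurrence is restarted at `m`, so that the known zeros of `g` become the arguments `0`
    -- and `suc m` required by `double-root-vanish`.
    shifted-recurrence : ∀ x → g (m ℕ.+ (2 ℕ.+ x)) + + 2 * g (m ℕ.+ (1 ℕ.+ x)) + g (m ℕ.+ x) ≡ 0ℤ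
    shifted-recurrence x rewrite ℕ.+-suc m (suc x) | ℕ.+-suc m x = g-recurrence (m ℕ.+ x)

flip-balanced : ∀ {c σ τ f} → (∀ x y → twisted c σ τ f x y ≡ 0ℤ) → ∀ x y → twisted c τ σ (flip f) x y ≡ 0ℤ
flip-balanced {c} {σ} {τ} {f} e x y = trans (twisted-flip c σ τ f x y) (e y x)

-- By `odd-equation` for `f` and for its transpose, `a` and `b` both act as the identity, and the
-- balance equation becomes `3 f = 0`. This holds first for coordinates from 2 on.
odd-vanish : ∀ {m n f}
  (antiˡ : ∀ y → Antiperiodic (suc m) (λ x → f x y)) (antiʳ : ∀ x → Antiperiodic (suc n) (f x)) →
  (∀ x y → twisted 1 1ℤ 1ℤ f x y ≡ 0ℤ) → (∀ x y → twisted 2 -1ℤ -1ℤ f x y ≡ 0ℤ) →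
  (∀ y → f 1 y ≡ f m y) → (∀ x → f x 1 ≡ f x n) → (∀ y → f 0 y ≡ 0ℤ) → (∀ x → f x 0 ≡ 0ℤ) →
  ∀ x y → f x y ≡ 0ℤ
odd-vanish {m} {n} {f} antiˡ antiʳ balanced e edgeˡ edgeʳ zeroˡ zeroʳ x y =
  antiperiodic-vanish 2 (antiˡ y) (λ x → antiperiodic-vanish 2 (antiʳ (2 ℕ.+ x)) (λ y →
    torsion-free 3 (trans
      (lemma (f (2 ℕ.+ x) (2 ℕ.+ y))
        (odd-equation antiˡ antiʳ balanced e edgeˡ zeroˡ (1 ℕ.+ x) y)
        (odd-equation antiʳ antiˡ (flip-balanced {1} {1ℤ} {1ℤ} {f} balanced)
          (flip-balanced {2} { -1ℤ} { -1ℤ} {f} e) edgeʳ zeroʳ (1 ℕ.+ y) x))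
      (balanced (1 ℕ.+ x) (1 ℕ.+ y)))) y) x
  where
  lemma : ∀ p {a b} → p ≡ a → p ≡ b → + 3 * p ≡ 1ℤ * 1ℤ * p + 1ℤ * a + 1ℤ * b
  lemma p refl refl = threefold p
    where
    threefold : ∀ p → + 3 * p ≡ 1ℤ * 1ℤ * p + 1ℤ * p + 1ℤ * p
    threefold = solve-∀

twisted⇒stencil-1 : ∀ {f} → (∀ x y → twisted 1 1ℤ 1ℤ f x y ≡ 0ℤ) → ∀ x y → ⟦ stencil neighbourhood 1 ⟧ f x y ≡ 0ℤ
twisted⇒stencil-1 {f} e x y = trans
  (lemma (f (1 ℕ.+ x) (1 ℕ.+ y)) (f (2 ℕ.+ x) (1 ℕ.+ y)) (f x (1 ℕ.+ y)) (f (1 ℕ.+ x) (2 ℕ.+ y)) (f (1 ℕ.+ x) y))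
  (e x y)
  where
  lemma : ∀ p a b c d → p + (a + (b + (c + (d + 0ℤ)))) ≡ 1ℤ * 1ℤ * p + 1ℤ * (a + b) + 1ℤ * (c + d)
  lemma = solve-∀

balanced-antiperiodic-vanish : ∀ {m n f} B →
  (∀ x y → ∣ f x y ∣ ≤ B) →
  (∀ y → Antiperiodic (suc m) (λ x → f x y)) → (∀ x → Antiperiodic (suc n) (f x)) →
  (∀ x y → twisted 1 1ℤ 1ℤ f x y ≡ 0ℤ) →
  (∀ y → f 1 y ≡ f m y) → (∀ x → f x 1 ≡ f x n) → (∀ y → f 0 y ≡ 0ℤ) → (∀ x → f x 0 ≡ 0ℤ) →
  ∀ x y → f x y ≡ 0ℤ
balanced-antiperiodic-vanish {m} {n} {f} B bound antiˡ antiʳ balanced edgeˡ edgeʳ zeroˡ zeroʳ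
  with common-multiple (suc m) (suc n)
... | s , t , sM≡tN , ¬even = result
  where
  open ≡-Reasoning
  M = suc m
  N = suc n
  -- A sum over the five cells is at most `5 * B`, so the dilation factor must avoid all primes up
  -- to `5 * B`. Being odd, `Q` preserves the parities of `s`, `t` and `L`.
  Q = oddProduct (5 ℕ.* B)
  Q-odd : alt Q ≡ -1ℤ
  Q-odd = alt-oddProduct (5 ℕ.* B)
  L = s ℕ.* M
  K = L ℕ.* Q

  kM : s ℕ.* Q ℕ.* M ≡ K
  kM = m*n*o≡m*o*n s Q M

  lN : t ℕ.* Q ℕ.* N ≡ K
  lN = trans (m*n*o≡m*o*n t Q N) (cong (ℕ._* Q) (sym sM≡tN))

  -- The dilation factor is `K + c`. The sign condition makes it odd: `c = 1` serves for even `L`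
  -- and `c = 2` for odd `L`.
  dilated : ∀ c .{{_ : ℕ.NonZero c}} {σ τ} → c ≤ 2 → alt L * alt c ≡ -1ℤ → alt s ≡ σ → alt t ≡ τ →
    ∀ x y → twisted c σ τ f x y ≡ 0ℤ
  dilated c c≤2 odd refl refl x y = begin
    twisted c (alt s) (alt t) f x y
      ≡⟨ cong₂ (λ σ τ → twisted c σ τ f x y) (alt-*-odd {Q} Q-odd s) (alt-*-odd {Q} Q-odd t) ⟨
    twisted c (alt (s ℕ.* Q)) (alt (t ℕ.* Q)) f x y
      ≡⟨ stencil-twisted antiˡ antiʳ c (s ℕ.* Q) (t ℕ.* Q) kM lN x y ⟨
    ⟦ stencil neighbourhood (K ℕ.+ c) ⟧ f x y
      ≡⟨ stencil-dilate-rough {neighbourhood} {f = f} bound (twisted⇒stencil-1 {f} balanced) (K ℕ.+ c) {{nz}}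
           (prime-divisor-large (5 ℕ.* B) K c c≤2 (n∣m*n L)
             (trans (alt-+ K c) (trans (cong (_* alt c) (alt-*-odd {Q} Q-odd L)) odd))) x y ⟩
    0ℤ ∎
    where
    nz : ℕ.NonZero (K ℕ.+ c)
    nz = ℕ.>-nonZero (ℕ.≤-trans (ℕ.>-nonZero⁻¹ c) (ℕ.m≤n+m c K))

  result : ∀ x y → f x y ≡ 0ℤ
  result with alt-cases s | alt-cases t
  ... | inj₁ (_ , 2∣s) | inj₁ (_ , 2∣t) = ⊥-elim (¬even (2∣s , 2∣t))
  -- The signs are 1 and -1 here; transposition brings them into the order of `left-vanish`.
  ... | inj₁ (s-even , _) | inj₂ t-odd = λ x y →
    left-vanish antiʳ antiˡ (flip-balanced {1} {1ℤ} {1ℤ} {f} balanced)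
      (flip-balanced {1} {1ℤ} { -1ℤ} {f} (dilated 1 (s≤s z≤n) (cong (_* -1ℤ) L-even) s-even t-odd)) y x
    where
    L-even : alt L ≡ 1ℤ
    L-even = trans (cong alt (ℕ.*-comm s M)) (alt-*-even {s} s-even M)
  ... | inj₂ s-odd | inj₁ (t-even , _) =
    left-vanish antiˡ antiʳ balanced (dilated 1 (s≤s z≤n) (cong (_* -1ℤ) L-even) s-odd t-even)
    where
    L-even : alt L ≡ 1ℤ
    L-even = trans (cong alt (trans sM≡tN (ℕ.*-comm t N))) (alt-*-even {t} t-even N)
  ... | inj₂ s-odd | inj₂ t-odd with alt-cases L
  ...   | inj₁ (L-even , _) = both-vanish antiˡ antiʳ balanced (dilated 1 (s≤s z≤n) (cong (_* -1ℤ) L-even) s-odd t-odd)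
  ...   | inj₂ L-odd =
    odd-vanish antiˡ antiʳ balanced (dilated 2 ℕ.≤-refl (cong (_* 1ℤ) L-odd) s-odd t-odd) edgeˡ edgeʳ zeroˡ zeroʳ

-- Antiperiodic extension of a symmetric function

antiperiodic-vanish-below : ∀ {m h} → Antiperiodic (suc m) h → (∀ x → x ≤ m → h x ≡ 0ℤ) → ∀ x → h x ≡ 0ℤ
antiperiodic-vanish-below {m} {h} anti e x = begin
  h x                                             ≡⟨ cong h (trans (m≡m%n+[m/n]*n x (suc m)) (ℕ.+-comm (x % suc m) _)) ⟩
  h (x / suc m ℕ.* suc m ℕ.+ x % suc m)           ≡⟨ antiperiodic-multiple anti (x / suc m) _ ⟩
  alt (x / suc m) * h (x % suc m)                 ≡⟨ cong (alt (x / suc m) *_) (e _ (ℕ.s≤s⁻¹ (m%n<n x (suc m)))) ⟩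
  alt (x / suc m) * 0ℤ                            ≡⟨ ℤ.*-zeroʳ (alt (x / suc m)) ⟩
  0ℤ                                              ∎
  where open ≡-Reasoning

∣alt∣ : ∀ n → ∣ alt n ∣ ≡ 1
∣alt∣ zero    = refl
∣alt∣ (suc n) = trans (ℤ.∣-i∣≡∣i∣ (alt n)) (∣alt∣ n)

∣alt*∣ : ∀ n i → ∣ alt n * i ∣ ≡ ∣ i ∣
∣alt*∣ n i = trans (ℤ.abs-* (alt n) i) (trans (cong (ℕ._* ∣ i ∣) (∣alt∣ n)) (ℕ.*-identityˡ ∣ i ∣))

extend : ℕ → (ℕ → ℤ) → ℕ → ℤ
extend m h x = alt (x / suc m) * h (x % suc m)

extend-antiperiodic : ∀ m h → Antiperiodic (suc m) (extend m h)
extend-antiperiodic m h x = begin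
  alt ((suc m ℕ.+ x) / suc m) * h ((suc m ℕ.+ x) % suc m)
    ≡⟨ cong₂ (λ q r → alt q * h r)
         (trans (+-distrib-/-∣ˡ x ∣-refl) (cong (ℕ._+ x / suc m) (n/n≡1 (suc m))))
         (%-remove-+ˡ x ∣-refl) ⟩
  - alt (x / suc m) * h (x % suc m)    ≡⟨ ℤ.neg-distribˡ-* (alt (x / suc m)) _ ⟨
  - extend m h x                       ∎
  where open ≡-Reasoning

extend-below : ∀ {m h x} → x ≤ m → extend m h x ≡ h x
extend-below {m} {h} {x} x≤m =
  trans (cong₂ (λ q r → alt q * h r) (m<n⇒m/n≡0 (s≤s x≤m)) (m<n⇒m%n≡m (s≤s x≤m))) (ℤ.*-identityˡ (h x))

-- At `x = m + 1` the extension has the value `- h 0`; it agrees with `h` there because both values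
-- vanish.
extend-≤ : ∀ {m h} → h 0 ≡ 0ℤ → h (suc m) ≡ 0ℤ → ∀ {x} → x ≤ suc m → extend m h x ≡ h x
extend-≤ {m} {h} h0 hM {x} x≤M with ℕ.m≤n⇒m<n∨m≡n x≤M
... | inj₁ (s≤s x≤m) = extend-below {m} {h} x≤m
... | inj₂ refl = begin
  extend m h (suc m)           ≡⟨ cong (extend m h) (ℕ.+-identityʳ (suc m)) ⟨
  extend m h (suc m ℕ.+ 0)     ≡⟨ extend-antiperiodic m h 0 ⟩
  - extend m h 0               ≡⟨ cong -_ (trans (extend-below {m} {h} z≤n) h0) ⟩
  0ℤ                           ≡⟨ hM ⟨
  h (suc m)                    ∎
  where open ≡-Reasoning

extend-edge : ∀ m {h} → h 0 ≡ 0ℤ → h 1 ≡ h m → extend m h 1 ≡ extend m h m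
-- For `m = 0` the argument 1 already lies in the next period, where the value is `- h 0`.
extend-edge zero    {h} h0 e = trans (extend-antiperiodic 0 h 0)
  (trans (cong (λ z → - (1ℤ * z)) h0) (sym (cong (1ℤ *_) h0)))
extend-edge (suc m) {h} h0 e = trans (extend-below {suc m} {h} (s≤s z≤n))
  (trans e (sym (extend-below {suc m} {h} ℕ.≤-refl)))

-- On the line of reflection the value vanishes and its two neighbours across the line cancel.
seam : ∀ {m f} → (∀ y → Antiperiodic (suc m) (λ x → f x y)) → (∀ y → f 0 y ≡ 0ℤ) → (∀ y → f 1 y ≡ f m y) →
  ∀ y → twisted 1 1ℤ 1ℤ f m y ≡ 0ℤ
seam {m} {f} anti zero-edge edge y = cancel (on-seam (1 ℕ.+ y)) across (on-seam (2 ℕ.+ y)) (on-seam y)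
  where
  on-seam : ∀ y → f (suc m) y ≡ 0ℤ
  on-seam y = trans (cong (λ x → f x y) (sym (ℕ.+-identityʳ (suc m)))) (trans (anti y 0) (cong -_ (zero-edge y)))
  across : f (2 ℕ.+ m) (1 ℕ.+ y) ≡ - f m (1 ℕ.+ y)
  across = trans (cong (λ x → f x (1 ℕ.+ y)) (ℕ.+-comm 1 (suc m))) (trans (anti _ 1) (cong -_ (edge _)))
  cancel : ∀ {p a b c d} → p ≡ 0ℤ → a ≡ - b → c ≡ 0ℤ → d ≡ 0ℤ → 1ℤ * 1ℤ * p + 1ℤ * (a + b) + 1ℤ * (c + d) ≡ 0ℤ
  cancel {b = b} refl refl refl refl = lemma b
    where
    lemma : ∀ b → 1ℤ * 1ℤ * 0ℤ + 1ℤ * (- b + b) + 1ℤ * (0ℤ + 0ℤ) ≡ 0ℤ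
    lemma = solve-∀

twisted-antiperiodic : ∀ {M f} → (∀ y → Antiperiodic M (λ x → f x y)) →
  ∀ y → Antiperiodic M (λ x → twisted 1 1ℤ 1ℤ f x y)
twisted-antiperiodic {M} {f} anti y x
  rewrite sym (ℕ.+-suc M x) | sym (ℕ.+-suc M (suc x))
        | anti (1 ℕ.+ y) (1 ℕ.+ x) | anti (1 ℕ.+ y) (2 ℕ.+ x) | anti (1 ℕ.+ y) x
        | anti (2 ℕ.+ y) (1 ℕ.+ x) | anti y (1 ℕ.+ x)
  = lemma (f (1 ℕ.+ x) (1 ℕ.+ y)) (f (2 ℕ.+ x) (1 ℕ.+ y)) (f x (1 ℕ.+ y)) (f (1 ℕ.+ x) (2 ℕ.+ y)) (f (1 ℕ.+ x) y)
  where
  lemma : ∀ p a b c d → 1ℤ * - p + 1ℤ * (- a + - b) + 1ℤ * (- c + - d) ≡ - (1ℤ * p + 1ℤ * (a + b) + 1ℤ * (c + d))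
  lemma = solve-∀

module _ {m n B : ℕ} {h : ℕ → ℕ → ℤ}
  (bound : ∀ x y → ∣ h x y ∣ ≤ B)
  (bottom : ∀ y → h 0 y ≡ 0ℤ) (top : ∀ y → h (suc m) y ≡ 0ℤ)
  (leftmost : ∀ x → h x 0 ≡ 0ℤ) (rightmost : ∀ x → h x (suc n) ≡ 0ℤ)
  (edgeˡ : ∀ y → h 1 y ≡ h m y) (edgeʳ : ∀ x → h x 1 ≡ h x n)
  (balanced : ∀ x y → x < m → y < n → twisted 1 1ℤ 1ℤ h x y ≡ 0ℤ) where

  private
    E : ℕ → ℕ → ℤ
    E x y = extend m (λ i → extend n (h i) y) x

    E-bound : ∀ x y → ∣ E x y ∣ ≤ B
    E-bound x y = subst (_≤ B)
      (sym (trans (∣alt*∣ (x / suc m) (extend n (h (x % suc m)) y)) (∣alt*∣ (y / suc n) (h (x % suc m) (y % suc n)))))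
      (bound (x % suc m) (y % suc n))

    E-antiˡ : ∀ y → Antiperiodic (suc m) (λ x → E x y)
    E-antiˡ y = extend-antiperiodic m (λ i → extend n (h i) y)

    E-antiʳ : ∀ x → Antiperiodic (suc n) (E x)
    E-antiʳ x y = trans (cong (alt (x / suc m) *_) (extend-antiperiodic n (h (x % suc m)) y))
                        (sym (ℤ.neg-distribʳ-* (alt (x / suc m)) (extend n (h (x % suc m)) y)))

    row-0 : ∀ {g} → (∀ y → g y ≡ 0ℤ) → ∀ y → extend n g y ≡ 0ℤ
    row-0 e y = trans (cong (alt (y / suc n) *_) (e _)) (ℤ.*-zeroʳ (alt (y / suc n)))

    E-≤ : ∀ {x y} → x ≤ suc m → y ≤ suc n → E x y ≡ h x y
    E-≤ {x} {y} x≤ y≤ = trans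
      (extend-≤ {m} {λ i → extend n (h i) y} (row-0 {h 0} bottom y) (row-0 {h (suc m)} top y) x≤)
      (extend-≤ {n} {h x} (leftmost x) (rightmost x) y≤)

    E-zeroˡ : ∀ y → E 0 y ≡ 0ℤ
    E-zeroˡ y = trans (ℤ.*-identityˡ (extend n (h 0) y)) (row-0 {h 0} bottom y)

    E-zeroʳ : ∀ x → E x 0 ≡ 0ℤ
    E-zeroʳ x = trans (cong (λ z → alt (x / suc m) * (1ℤ * z)) (leftmost _)) (ℤ.*-zeroʳ (alt (x / suc m)))

    E-edgeˡ : ∀ y → E 1 y ≡ E m y
    E-edgeˡ y = extend-edge m {λ i → extend n (h i) y} (row-0 {h 0} bottom y)
      (cong (alt (y / suc n) *_) (edgeˡ (y % suc n)))

    E-edgeʳ : ∀ x → E x 1 ≡ E x n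
    E-edgeʳ x = cong (alt (x / suc m) *_) (extend-edge n {h (x % suc m)} (leftmost _) (edgeʳ _))

    -- The centre is `(x + 1 , y + 1)`. For `x = m` or `y = n` it lies on a line of reflection, and
    -- `seam` applies; otherwise all five cells lie in the padded box, where `E` is `h`.
    E-balanced-below : ∀ x y → x ≤ m → y ≤ n → twisted 1 1ℤ 1ℤ E x y ≡ 0ℤ
    E-balanced-below x y x≤m y≤n with ℕ.m≤n⇒m<n∨m≡n x≤m | ℕ.m≤n⇒m<n∨m≡n y≤n
    ... | inj₂ refl | _ = seam E-antiˡ E-zeroˡ E-edgeˡ y
    ... | inj₁ x<m | inj₂ refl = trans (sym (twisted-flip 1 1ℤ 1ℤ E n x)) (seam {f = flip E} E-antiʳ E-zeroʳ E-edgeʳ x)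
    ... | inj₁ x<m | inj₁ y<n
      rewrite E-≤ (s≤s x≤m) (s≤s y≤n) | E-≤ (s≤s x<m) (s≤s y≤n) | E-≤ (ℕ.m≤n⇒m≤1+n x≤m) (s≤s y≤n)
            | E-≤ (s≤s x≤m) (s≤s y<n) | E-≤ (s≤s x≤m) (ℕ.m≤n⇒m≤1+n y≤n) = balanced x y x<m y<n

    E-balanced : ∀ x y → twisted 1 1ℤ 1ℤ E x y ≡ 0ℤ
    E-balanced x y = antiperiodic-vanish-below (twisted-antiperiodic E-antiˡ y)
      (λ x x≤m → antiperiodic-vanish-below (twisted-antiperiodicʳ x) (λ y → E-balanced-below x y x≤m) y) x
      where
      twisted-antiperiodicʳ : ∀ x → Antiperiodic (suc n) (twisted 1 1ℤ 1ℤ E x)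
      twisted-antiperiodicʳ x y = begin
        twisted 1 1ℤ 1ℤ E x (suc n ℕ.+ y)         ≡⟨ twisted-flip 1 1ℤ 1ℤ E _ x ⟨
        twisted 1 1ℤ 1ℤ (flip E) (suc n ℕ.+ y) x  ≡⟨ twisted-antiperiodic {f = flip E} E-antiʳ x y ⟩
        - twisted 1 1ℤ 1ℤ (flip E) y x            ≡⟨ cong -_ (twisted-flip 1 1ℤ 1ℤ E y x) ⟩
        - twisted 1 1ℤ 1ℤ E x y                   ∎
        where open ≡-Reasoning

  symmetric-vanish : ∀ {x y} → x ≤ suc m → y ≤ suc n → h x y ≡ 0ℤ
  symmetric-vanish {x} {y} x≤ y≤ = trans (sym (E-≤ x≤ y≤))
    (balanced-antiperiodic-vanish B E-bound E-antiˡ E-antiʳ E-balanced E-edgeˡ E-edgeʳ E-zeroˡ E-zeroʳ x y)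

-- Neighbourhood sums on the grid

open CMSum ℤ.+-0-commutativeMonoid using (sum; sum-remove; sum-cong-≗; ∑-distrib-+; sum-permute; sum-replicate-zero)

sum-zero : ∀ {n} {t : Fin n → ℤ} → (∀ i → t i ≡ 0ℤ) → sum t ≡ 0ℤ
sum-zero {n} e = trans (sum-cong-≗ e) (sum-replicate-zero n)

sum-single : ∀ {n} (t : Fin n → ℤ) i → (∀ j → j ≢ i → t j ≡ 0ℤ) → sum t ≡ t i
sum-single {suc n} t i e = begin
  sum t                             ≡⟨ sum-remove {i = i} t ⟩
  t i + sum (λ j → t (punchIn i j)) ≡⟨ cong (_+_ (t i)) (sum-zero (λ j → e _ (Fin.punchInᵢ≢i i j))) ⟩
  t i + 0ℤ                          ≡⟨ ℤ.+-identityʳ (t i) ⟩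
  t i                               ∎
  where open ≡-Reasoning

module _ (G : Graph) where
  open Graph G
  private module enum = Inverse enum

  ∑ⱽ-cong : ∀ s t → (∀ u → s u ≡ t u) → ∑ⱽ s ≡ ∑ⱽ t
  ∑ⱽ-cong s t e = sum-cong-≗ (λ i → e (enum.from i))

  ∑ⱽ-zero : ∀ {t} → (∀ u → t u ≡ 0ℤ) → ∑ⱽ t ≡ 0ℤ
  ∑ⱽ-zero e = sum-zero (λ i → e (enum.from i))

  ∑ⱽ-+ : ∀ s t → ∑ⱽ (λ u → s u + t u) ≡ ∑ⱽ s + ∑ⱽ t
  ∑ⱽ-+ s t = ∑-distrib-+ (λ i → s (enum.from i)) (λ i → t (enum.from i))

  ∑ⱽ-single : ∀ t v → (∀ u → u ≢ v → t u ≡ 0ℤ) → ∑ⱽ t ≡ t v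
  ∑ⱽ-single t v e = trans
    (sum-single (λ i → t (enum.from i)) (enum.to v)
      (λ j j≢v → e _ (λ eq → j≢v (trans (sym (enum.strictlyInverseˡ j)) (cong enum.to eq)))))
    (cong t (enum.strictlyInverseʳ v))

  ∑ⱽ-permute : ∀ t (σ : V ↔ V) → ∑ⱽ (λ u → t (Inverse.to σ u)) ≡ ∑ⱽ t
  -- Conjugation by `enum` turns `σ` into a permutation of the indices.
  ∑ⱽ-permute t σ = sym (trans
    (sum-permute (λ i → t (enum.from i)) (enum ↔-∘ (σ ↔-∘ ↔-sym enum)))
    (sum-cong-≗ (λ i → cong t (enum.strictlyInverseʳ (Inverse.to σ (enum.from i))))))

-- The summand of `∑N[_]` as a function of the decision, so that one membership test can be
-- exchanged for an equivalent one.
restrict : ∀ {P : Set} → Dec P → ℤ → ℤ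
restrict P? z = if does P? then z else 0ℤ

restrict-yes : ∀ {P : Set} (P? : Dec P) {z} → P → restrict P? z ≡ z
restrict-yes P? {z} p = cong (λ b → if b then z else 0ℤ) (dec-true P? p)

restrict-no : ∀ {P : Set} (P? : Dec P) {z} → ¬ P → restrict P? z ≡ 0ℤ
restrict-no P? {z} ¬p = cong (λ b → if b then z else 0ℤ) (dec-false P? ¬p)

restrict-⇔ : ∀ {P Q : Set} → P ⇔ Q → (P? : Dec P) (Q? : Dec Q) → ∀ z → restrict P? z ≡ restrict Q? z
restrict-⇔ P⇔Q P? Q? z = cong (λ b → if b then z else 0ℤ) (does-⇔ P⇔Q P? Q?)

restrict-⊎ : ∀ {P Q : Set} (P? : Dec P) (Q? : Dec Q) → (P → Q → ⊥) →
  ∀ z → restrict (P? ⊎-dec Q?) z ≡ restrict P? z + restrict Q? z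
restrict-⊎ (yes p) Q? ¬pq z = sym (trans (cong (_+_ z) (restrict-no Q? (¬pq p))) (ℤ.+-identityʳ z))
restrict-⊎ (no ¬p) Q? ¬pq z = sym (ℤ.+-identityˡ _)

module _ {m n : ℕ} where
  private
    module G = Graph (Grid m n)

  -- Vertex (i , j) sits at the lattice point (suc i , suc j), leaving room for a zero border.
  At : ℕ → ℕ → Fin m × Fin n → Set
  At x y u = x ≡ suc (toℕ (proj₁ u)) × y ≡ suc (toℕ (proj₂ u))

  at? : ∀ x y u → Dec (At x y u)
  at? x y u = (x ℕ.≟ suc (toℕ (proj₁ u))) ×-dec (y ℕ.≟ suc (toℕ (proj₂ u)))

  at-injective : ∀ {x y u v} → At x y u → At x y v → u ≡ v
  at-injective (p , q) (p′ , q′) = cong₂ _,_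
    (Fin.toℕ-injective (ℕ.suc-injective (trans (sym p) p′)))
    (Fin.toℕ-injective (ℕ.suc-injective (trans (sym q) q′)))

  -- A sum with at most one nonzero term: it is 0 off the grid without any case distinction, and
  -- neighbourhood sums split into its values by additivity.
  pad : (Fin m × Fin n → ℤ) → ℕ → ℕ → ℤ
  pad f x y = G.∑ⱽ (λ u → restrict (at? x y u) (f u))

  pad-at : ∀ f {x y} u → At x y u → pad f x y ≡ f u
  pad-at f {x} {y} u at = trans
    (∑ⱽ-single (Grid m n) (λ u → restrict (at? x y u) (f u)) u
      (λ v v≢u → restrict-no (at? x y v) (λ at′ → v≢u (at-injective at′ at))))
    (restrict-yes (at? x y u) at)

  pad-outside : ∀ f x y → (∀ u → ¬ At x y u) → pad f x y ≡ 0ℤ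
  pad-outside f x y out = ∑ⱽ-zero (Grid m n) (λ u → restrict-no (at? x y u) {f u} (out u))

  pad-bound : ∀ {f B} → (∀ u → ∣ f u ∣ ≤ B) → ∀ x y → ∣ pad f x y ∣ ≤ B
  pad-bound {f} {B} bound x y with Fin.any? (λ i → Fin.any? (λ j → at? x y (i , j)))
  ... | yes (i , j , at) = subst (λ z → ∣ z ∣ ≤ B) (sym (pad-at f (i , j) at)) (bound (i , j))
  ... | no ∄ = subst (λ z → ∣ z ∣ ≤ B) (sym (pad-outside f x y (λ (i , j) at → ∄ (i , j , at)))) z≤n

  module _ (a : Fin m) (b : Fin n) where
    private
      x = toℕ a
      y = toℕ b

      Cross : Fin m × Fin n → Set
      Cross u = At (1 ℕ.+ x) (1 ℕ.+ y) u ⊎ At (2 ℕ.+ x) (1 ℕ.+ y) u ⊎ At x (1 ℕ.+ y) u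
              ⊎ At (1 ℕ.+ x) (2 ℕ.+ y) u ⊎ At (1 ℕ.+ x) y u

      N⇔Cross : ∀ u → (u G.∈N[ (a , b) ]) ⇔ Cross u
      N⇔Cross u = mk⇔ to from
        where
        to : u G.∈N[ (a , b) ] → Cross u
        to (inj₂ refl)                         = inj₁ (refl , refl)
        to (inj₁ (inj₂ (inj₂ p , refl)))       = inj₂ (inj₁ (cong suc (sym p) , refl))
        to (inj₁ (inj₂ (inj₁ p , refl)))       = inj₂ (inj₂ (inj₁ (p , refl)))
        to (inj₁ (inj₁ (refl , inj₂ q)))       = inj₂ (inj₂ (inj₂ (inj₁ (refl , cong suc (sym q)))))
        to (inj₁ (inj₁ (refl , inj₁ q)))       = inj₂ (inj₂ (inj₂ (inj₂ (refl , q))))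
        same : ∀ {k} {i j : Fin k} → suc (toℕ i) ≡ suc (toℕ j) → j ≡ i
        same e = sym (Fin.toℕ-injective (ℕ.suc-injective e))
        from : Cross u → u G.∈N[ (a , b) ]
        from (inj₁ (p , q))                         = inj₂ (cong₂ _,_ (same p) (same q))
        from (inj₂ (inj₁ (p , q)))                  = inj₁ (inj₂ (inj₂ (sym (ℕ.suc-injective p)) , same q))
        from (inj₂ (inj₂ (inj₁ (p , q))))           = inj₁ (inj₂ (inj₁ p , same q))
        from (inj₂ (inj₂ (inj₂ (inj₁ (p , q)))))    = inj₁ (inj₁ (same p , inj₂ (sym (ℕ.suc-injective q))))
        from (inj₂ (inj₂ (inj₂ (inj₂ (p , q)))))    = inj₁ (inj₁ (same p , inj₁ q))

      apartˡ : ∀ {x x′ y y′ u} → x ≢ x′ → At x y u → At x′ y′ u → ⊥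
      apartˡ x≢ (p , _) (p′ , _) = x≢ (trans p (sym p′))
      apartʳ : ∀ {x x′ y y′ u} → y ≢ y′ → At x y u → At x′ y′ u → ⊥
      apartʳ y≢ (_ , q) (_ , q′) = y≢ (trans q (sym q′))

      n≢1+n : ∀ {k} → k ≢ suc k
      n≢1+n e = ℕ.1+n≢n (sym e)
      2+n≢n : ∀ {k} → suc (suc k) ≢ k
      2+n≢n {k} e = ℕ.m≢1+m+n k (trans (sym e) (cong suc (ℕ.+-comm 1 k)))

      -- The five points of the cross are pairwise distinct, so the disjunction becomes a sum.
      -- Points on the border match no vertex and contribute 0.
      restrict-cross : ∀ (f : Fin m × Fin n → ℤ) u → restrict (u G.∈N[ (a , b) ]?) (f u) ≡
        restrict (at? (1 ℕ.+ x) (1 ℕ.+ y) u) (f u) + (restrict (at? (2 ℕ.+ x) (1 ℕ.+ y) u) (f u) +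
        (restrict (at? x (1 ℕ.+ y) u) (f u) + (restrict (at? (1 ℕ.+ x) (2 ℕ.+ y) u) (f u) +
        restrict (at? (1 ℕ.+ x) y u) (f u))))
      restrict-cross f u = trans
        (restrict-⇔ (N⇔Cross u) (u G.∈N[ (a , b) ]?) (P₁ ⊎-dec (P₂ ⊎-dec (P₃ ⊎-dec (P₄ ⊎-dec P₅)))) (f u))
        (trans (restrict-⊎ P₁ (P₂ ⊎-dec (P₃ ⊎-dec (P₄ ⊎-dec P₅))) d₁ (f u)) (cong (_+_ (restrict P₁ (f u)))
        (trans (restrict-⊎ P₂ (P₃ ⊎-dec (P₄ ⊎-dec P₅)) d₂ (f u)) (cong (_+_ (restrict P₂ (f u)))
        (trans (restrict-⊎ P₃ (P₄ ⊎-dec P₅) d₃ (f u)) (cong (_+_ (restrict P₃ (f u)))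
        (restrict-⊎ P₄ P₅ (apartʳ {u = u} 2+n≢n) (f u))))))))
        where
        P₁ = at? (1 ℕ.+ x) (1 ℕ.+ y) u
        P₂ = at? (2 ℕ.+ x) (1 ℕ.+ y) u
        P₃ = at? x (1 ℕ.+ y) u
        P₄ = at? (1 ℕ.+ x) (2 ℕ.+ y) u
        P₅ = at? (1 ℕ.+ x) y u
        d₃ : At x (1 ℕ.+ y) u → At (1 ℕ.+ x) (2 ℕ.+ y) u ⊎ At (1 ℕ.+ x) y u → ⊥
        d₃ p (inj₁ q) = apartˡ {u = u} n≢1+n p q
        d₃ p (inj₂ q) = apartˡ {u = u} n≢1+n p q
        d₂ : At (2 ℕ.+ x) (1 ℕ.+ y) u → At x (1 ℕ.+ y) u ⊎ At (1 ℕ.+ x) (2 ℕ.+ y) u ⊎ At (1 ℕ.+ x) y u → ⊥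
        d₂ p (inj₁ q)        = apartˡ {u = u} 2+n≢n p q
        d₂ p (inj₂ (inj₁ q)) = apartˡ {u = u} ℕ.1+n≢n p q
        d₂ p (inj₂ (inj₂ q)) = apartˡ {u = u} ℕ.1+n≢n p q
        d₁ : At (1 ℕ.+ x) (1 ℕ.+ y) u →
          At (2 ℕ.+ x) (1 ℕ.+ y) u ⊎ At x (1 ℕ.+ y) u ⊎ At (1 ℕ.+ x) (2 ℕ.+ y) u ⊎ At (1 ℕ.+ x) y u → ⊥
        d₁ p (inj₁ q)               = apartˡ {u = u} n≢1+n p q
        d₁ p (inj₂ (inj₁ q))        = apartˡ {u = u} ℕ.1+n≢n p q
        d₁ p (inj₂ (inj₂ (inj₁ q))) = apartʳ {u = u} n≢1+n p q
        d₁ p (inj₂ (inj₂ (inj₂ q))) = apartʳ {u = u} ℕ.1+n≢n p q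

    ∑N-pad : ∀ f → G.∑N[ (a , b) ] f ≡ twisted 1 1ℤ 1ℤ (pad f) x y
    ∑N-pad f = begin
      G.∑N[ (a , b) ] f
        ≡⟨ ∑ⱽ-cong (Grid m n) (λ u → restrict (u G.∈N[ (a , b) ]?) (f u)) (r₁ ⊞ (r₂ ⊞ (r₃ ⊞ (r₄ ⊞ r₅))))
             (restrict-cross f) ⟩
      G.∑ⱽ (r₁ ⊞ (r₂ ⊞ (r₃ ⊞ (r₄ ⊞ r₅))))
        -- Each vertex sum of an `rᵢ` is a value of `pad f` by definition.
        ≡⟨ split r₁ (r₂ ⊞ (r₃ ⊞ (r₄ ⊞ r₅)))
             (split r₂ (r₃ ⊞ (r₄ ⊞ r₅)) (split r₃ (r₄ ⊞ r₅) (split r₄ r₅ refl))) ⟩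
      F (1 ℕ.+ x) (1 ℕ.+ y) + (F (2 ℕ.+ x) (1 ℕ.+ y) + (F x (1 ℕ.+ y) + (F (1 ℕ.+ x) (2 ℕ.+ y) + F (1 ℕ.+ x) y)))
        ≡⟨ lemma (F (1 ℕ.+ x) (1 ℕ.+ y)) (F (2 ℕ.+ x) (1 ℕ.+ y)) (F x (1 ℕ.+ y))
             (F (1 ℕ.+ x) (2 ℕ.+ y) + F (1 ℕ.+ x) y) ⟩
      twisted 1 1ℤ 1ℤ F x y ∎
      where
      open ≡-Reasoning
      F = pad f
      r : ℕ → ℕ → Fin m × Fin n → ℤ
      r x y u = restrict (at? x y u) (f u)
      r₁ = r (1 ℕ.+ x) (1 ℕ.+ y)
      r₂ = r (2 ℕ.+ x) (1 ℕ.+ y)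
      r₃ = r x (1 ℕ.+ y)
      r₄ = r (1 ℕ.+ x) (2 ℕ.+ y)
      r₅ = r (1 ℕ.+ x) y
      infixr 6 _⊞_
      _⊞_ : (s t : Fin m × Fin n → ℤ) → Fin m × Fin n → ℤ
      (s ⊞ t) u = s u + t u
      split : ∀ s t {z} → G.∑ⱽ t ≡ z → G.∑ⱽ (s ⊞ t) ≡ G.∑ⱽ s + z
      split s t e = trans (∑ⱽ-+ (Grid m n) s t) (cong (_+_ (G.∑ⱽ s)) e)
      lemma : ∀ p a b c → p + (a + (b + c)) ≡ 1ℤ * 1ℤ * p + 1ℤ * (a + b) + 1ℤ * c
      lemma = solve-∀

-- Symmetrisation

-- The reflection is that of `0 .. k`; for larger `x` truncated subtraction makes the second term
-- `h 0`.
symmetrise : ℕ → (ℕ → ℤ) → ℕ → ℤ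
symmetrise k h x = h x + h (k ℕ.∸ x)

symmetrise-zero : ∀ {k h} → h 0 ≡ 0ℤ → h k ≡ 0ℤ → symmetrise k h 0 ≡ 0ℤ × symmetrise k h k ≡ 0ℤ
symmetrise-zero {k} {h} h0 hk = cong₂ _+_ h0 hk , cong₂ _+_ hk (trans (cong h (ℕ.n∸n≡0 k)) h0)

-- The reflection of `0 .. m + 1` swaps `1` and `m`.
symmetrise-edge : ∀ m h → symmetrise (suc m) h 1 ≡ symmetrise (suc m) h m
symmetrise-edge m h = trans (ℤ.+-comm (h 1) (h m)) (cong (λ k → h m + h k) (sym (ℕ.m+n∸n≡m 1 m)))

symmetrise-bound : ∀ {k h B} → (∀ x → ∣ h x ∣ ≤ B) → ∀ x → ∣ symmetrise k h x ∣ ≤ B ℕ.+ B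
symmetrise-bound {k} {h} bound x =
  ℕ.≤-trans (ℤ.∣i+j∣≤∣i∣+∣j∣ (h x) (h (k ℕ.∸ x))) (ℕ.+-mono-≤ (bound x) (bound (k ℕ.∸ x)))

Balanced : ℕ → ℕ → (ℕ → ℕ → ℤ) → Set
Balanced m n h = ∀ x y → x < m → y < n → twisted 1 1ℤ 1ℤ h x y ≡ 0ℤ

Balanced-flip : ∀ {m n} h → Balanced m n h → Balanced n m (flip h)
Balanced-flip h e x y x<n y<m = trans (twisted-flip 1 1ℤ 1ℤ h x y) (e y x y<m x<n)

symmetriseˡ : ℕ → (ℕ → ℕ → ℤ) → ℕ → ℕ → ℤ
symmetriseˡ k h x y = symmetrise k (λ i → h i y) x

symmetriseʳ : ℕ → (ℕ → ℕ → ℤ) → ℕ → ℕ → ℤ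
symmetriseʳ k h x = symmetrise k (h x)

shift∸ : ∀ k x y → k ℕ.+ (x ℕ.+ y) ℕ.∸ x ≡ k ℕ.+ y
shift∸ k x y = trans (ℕ.+-∸-assoc k (ℕ.m≤m+n x y)) (cong (k ℕ.+_) (ℕ.m+n∸m≡n x y))

Balanced-symmetriseˡ : ∀ {m n} h → Balanced m n h → Balanced m n (symmetriseˡ (suc m) h)
Balanced-symmetriseˡ {m} {n} h e x y x<m y<n
  -- With `x + 1 + x′ = m` the mirror image of the centre `x + 1` is `x′ + 1`, and its two
  -- neighbours across are exchanged. The sum is thus the balance at `x` plus the balance at `x′`.
  with x′ , refl ← ℕ.m≤n⇒∃[o]m+o≡n x<m
  rewrite shift∸ 0 x x′ | shift∸ 1 x x′ | shift∸ 2 x x′ =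
  lemma (h (1 ℕ.+ x) (1 ℕ.+ y)) (h (2 ℕ.+ x) (1 ℕ.+ y)) (h x (1 ℕ.+ y)) (h (1 ℕ.+ x) (2 ℕ.+ y)) (h (1 ℕ.+ x) y)
        (h (1 ℕ.+ x′) (1 ℕ.+ y)) (h (2 ℕ.+ x′) (1 ℕ.+ y)) (h x′ (1 ℕ.+ y)) (h (1 ℕ.+ x′) (2 ℕ.+ y)) (h (1 ℕ.+ x′) y)
        (e x y x<m y<n) (e x′ y (s≤s (ℕ.m≤n+m x′ x)) y<n)
  where
  lemma : ∀ p a b c d p′ a′ b′ c′ d′ →
    1ℤ * 1ℤ * p + 1ℤ * (a + b) + 1ℤ * (c + d) ≡ 0ℤ → 1ℤ * 1ℤ * p′ + 1ℤ * (a′ + b′) + 1ℤ * (c′ + d′) ≡ 0ℤ →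
    1ℤ * 1ℤ * (p + p′) + 1ℤ * ((a + b′) + (b + a′)) + 1ℤ * ((c + c′) + (d + d′)) ≡ 0ℤ
  lemma p a b c d p′ a′ b′ c′ d′ e e′ = trans (regroup p a b c d p′ a′ b′ c′ d′) (cong₂ _+_ e e′)
    where
    regroup : ∀ p a b c d p′ a′ b′ c′ d′ →
      1ℤ * 1ℤ * (p + p′) + 1ℤ * ((a + b′) + (b + a′)) + 1ℤ * ((c + c′) + (d + d′)) ≡
      (1ℤ * 1ℤ * p + 1ℤ * (a + b) + 1ℤ * (c + d)) + (1ℤ * 1ℤ * p′ + 1ℤ * (a′ + b′) + 1ℤ * (c′ + d′))
    regroup = solve-∀

reflections-vanish : ∀ {m n B} h → (∀ x y → ∣ h x y ∣ ≤ B) →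
  (∀ y → h 0 y ≡ 0ℤ) → (∀ y → h (suc m) y ≡ 0ℤ) → (∀ x → h x 0 ≡ 0ℤ) → (∀ x → h x (suc n) ≡ 0ℤ) →
  Balanced m n h → ∀ {x y} → x ≤ suc m → y ≤ suc n →
  symmetriseʳ (suc n) (symmetriseˡ (suc m) h) x y ≡ 0ℤ
reflections-vanish {m} {n} {B} h bound bottom top leftmost rightmost balanced =
  symmetric-vanish {m} {n} {h = s}
    -- Each of the two symmetrisations doubles the bound, which is how values bounded by 1 lead to
    -- the bound 4.
    (λ x y → symmetrise-bound {suc n} {sˡ x} (sˡ-bound x) y)
    (λ y → cong₂ _+_ (sˡ-bottom y) (sˡ-bottom (suc n ℕ.∸ y)))
    (λ y → cong₂ _+_ (sˡ-top y) (sˡ-top (suc n ℕ.∸ y)))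
    (λ x → proj₁ (symmetrise-zero {suc n} {sˡ x} (sˡ-leftmost x) (sˡ-rightmost x)))
    (λ x → proj₂ (symmetrise-zero {suc n} {sˡ x} (sˡ-leftmost x) (sˡ-rightmost x)))
    (λ y → cong₂ _+_ (sˡ-edge y) (sˡ-edge (suc n ℕ.∸ y)))
    (λ x → symmetrise-edge n (sˡ x))
    -- Symmetrising in the second coordinate is symmetrising the transpose in the first.
    (Balanced-flip (flip s) (Balanced-symmetriseˡ (flip sˡ) (Balanced-flip sˡ (Balanced-symmetriseˡ h balanced))))
  where
  sˡ = symmetriseˡ (suc m) h
  s = symmetriseʳ (suc n) sˡ
  sˡ-bound : ∀ x y → ∣ sˡ x y ∣ ≤ B ℕ.+ B
  sˡ-bound x y = symmetrise-bound {suc m} {λ i → h i y} (λ i → bound i y) x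
  sˡ-bottom : ∀ y → sˡ 0 y ≡ 0ℤ
  sˡ-bottom y = proj₁ (symmetrise-zero {suc m} {λ i → h i y} (bottom y) (top y))
  sˡ-top : ∀ y → sˡ (suc m) y ≡ 0ℤ
  sˡ-top y = proj₂ (symmetrise-zero {suc m} {λ i → h i y} (bottom y) (top y))
  sˡ-leftmost : ∀ x → sˡ x 0 ≡ 0ℤ
  sˡ-leftmost x = cong₂ _+_ (leftmost x) (leftmost (suc m ℕ.∸ x))
  sˡ-rightmost : ∀ x → sˡ x (suc n) ≡ 0ℤ
  sˡ-rightmost x = cong₂ _+_ (rightmost x) (rightmost (suc m ℕ.∸ x))
  sˡ-edge : ∀ y → sˡ 1 y ≡ sˡ m y
  sˡ-edge y = symmetrise-edge m (λ i → h i y)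

-- The weight of a balanced domination function

suc-opposite : ∀ {n} (i : Fin n) → n ℕ.∸ toℕ i ≡ suc (toℕ (opposite i))
suc-opposite {n} i = trans (ℕ.+-∸-assoc 1 (Fin.toℕ<n i)) (cong suc (sym (Fin.opposite-prop i)))

module _ {m n : ℕ} {f : Fin m × Fin n → ℤ} (bdf : IsBDF (Grid m n) f) where
  open IsBDF bdf

  private
    reflectˡ reflectʳ reflect : (Fin m × Fin n) ↔ (Fin m × Fin n)
    reflectˡ = reverse ×-↔ ↔-id _
    reflectʳ = ↔-id _ ×-↔ reverse
    reflect  = reverse ×-↔ reverse

    value-bound : ∀ {z} → z ∈ -1ℤ ∷ 0ℤ ∷ 1ℤ ∷ [] → ∣ z ∣ ≤ 1
    value-bound (here refl)                 = s≤s z≤n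
    value-bound (there (here refl))         = z≤n
    value-bound (there (there (here refl))) = s≤s z≤n

    F = pad f

    F-balanced : Balanced m n F
    F-balanced x y x<m y<n = subst₂ (λ x y → twisted 1 1ℤ 1ℤ F x y ≡ 0ℤ) (Fin.toℕ-fromℕ< x<m) (Fin.toℕ-fromℕ< y<n)
      (trans (sym (∑N-pad (fromℕ< x<m) (fromℕ< y<n) f)) (balanced _))

    beyond : ∀ {k} (i : Fin k) → suc k ≢ suc (toℕ i)
    beyond i e = ℕ.<⇒≢ (Fin.toℕ<n i) (sym (ℕ.suc-injective e))

  reflections-cancel : ∀ u →
    (f u + f (Inverse.to reflectˡ u)) + (f (Inverse.to reflectʳ u) + f (Inverse.to reflect u)) ≡ 0ℤ
  -- Padded coordinates are one larger, so `opposite` becomes `x ↦ m + 1 - x` (with `n` for `m` in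
  -- the second coordinate), and the four terms are those of the double symmetrisation at
  -- `(i + 1 , j + 1)`.
  reflections-cancel (i , j) = trans
    (sym (cong₂ _+_ (cong₂ _+_ (pad-at f _ (refl , refl)) (pad-at f _ (suc-opposite i , refl)))
                    (cong₂ _+_ (pad-at f _ (refl , suc-opposite j)) (pad-at f _ (suc-opposite i , suc-opposite j)))))
    (reflections-vanish F (pad-bound {f = f} (λ u → value-bound (values u)))
      (λ y → pad-outside f 0 y λ { u (() , _) })
      (λ y → pad-outside f (suc m) y (λ u (e , _) → beyond (proj₁ u) e))
      (λ x → pad-outside f x 0 λ { u (_ , ()) })
      (λ x → pad-outside f x (suc n) (λ u (_ , e) → beyond (proj₂ u) e))
      F-balanced (s≤s (ℕ.<⇒≤ (Fin.toℕ<n i))) (s≤s (ℕ.<⇒≤ (Fin.toℕ<n j))))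

  -- Reflections permute the vertices and preserve the total, so summing `reflections-cancel` over
  -- all vertices gives four times the weight.
  weight-zero : weight (Grid m n) f ≡ 0ℤ
  weight-zero = torsion-free 4 (begin
    + 4 * w
      ≡⟨ fourfold w ⟩
    (w + w) + (w + w)
      ≡⟨ cong₂ _+_ (cong (_+_ w) (permute reflectˡ)) (cong₂ _+_ (permute reflectʳ) (permute reflect)) ⟨
    (w + ∑ fˡ) + (∑ fʳ + ∑ fᵒ)
      ≡⟨ cong₂ _+_ (∑ⱽ-+ G f fˡ) (∑ⱽ-+ G fʳ fᵒ) ⟨
    ∑ (λ u → f u + fˡ u) + ∑ (λ u → fʳ u + fᵒ u)
      ≡⟨ ∑ⱽ-+ G (λ u → f u + fˡ u) (λ u → fʳ u + fᵒ u) ⟨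
    ∑ (λ u → (f u + fˡ u) + (fʳ u + fᵒ u))
      ≡⟨ ∑ⱽ-zero G reflections-cancel ⟩
    0ℤ ∎)
    where
    open ≡-Reasoning
    G = Grid m n
    ∑ = Graph.∑ⱽ G
    w = ∑ f
    fˡ fʳ fᵒ : Fin m × Fin n → ℤ
    fˡ u = f (Inverse.to reflectˡ u)
    fʳ u = f (Inverse.to reflectʳ u)
    fᵒ u = f (Inverse.to reflect u)
    permute : ∀ σ → ∑ (λ u → f (Inverse.to σ u)) ≡ w
    permute = ∑ⱽ-permute G f
    fourfold : ∀ w → + 4 * w ≡ (w + w) + (w + w)
    fourfold = solve-∀

zero-isBDF : ∀ G → IsBDF G (λ _ → 0ℤ)
zero-isBDF G = record
  { values   = λ _ → there (here refl)
  ; balanced = λ v → ∑ⱽ-zero G (λ u → if-eta (does (u ∈N[ v ]?)))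
  }
  where
  open Graph G

mainTheorem7 : ∀ (m n : ℕ) → 3 ≤ m → m ≤ n → DBalanced (Grid m n)
mainTheorem7 m n _ _ =
  ((λ _ → 0ℤ) , zero-isBDF (Grid m n) , ∑ⱽ-zero (Grid m n) (λ _ → refl)) ,
  λ f bdf → ℤ.≤-reflexive (weight-zero bdf)
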